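{- For all integers $n\ge 1$ and $0\le m\le t(n)$, $$f_3(n,m)=\min\left\{\sum_{i=1}^k s(q_i):\ k,q_1,\ldots,q_k\in\mathbb N,\ \sum_{i=1}^k q_i=n,\ \sum_{i=1}^k t(q_i)\ge m\right\}.$$
   Context: All graphs are finite and simple; $\mathbb N$ denotes the positive integers. For a positive integer $q$, $t(q)=\lfloor q^2/4\rfloor$ and $s(q)=\lfloor (q-1)^2/4\rfloor$. For a triangle-free graph $G$, a non-edge $xy$ (an unordered pair of distinct non-adjacent vertices) is triangle-saturating if $G+xy$ contains a triangle. $f_3(G)$ is the number of triangle-saturating non-edges of $G$, and $f_3(n,m)$ is the minimum of $f_3(G)$ over all triangle-free graphs $G$ with $n$ vertices and $m$ edges. -}

module Defs where

open import Data.Fin using (Fin; _<?_; _≟_)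
open import Data.Fin.Properties using (any?)
open import Data.List using (List; length; filter; allFin; cartesianProduct)
open import Data.Nat using (ℕ; _∸_; _^_; _/_; _≤_; _≥_)
open import Data.Product using (Σ-syntax; ∃-syntax; _×_; _,_; uncurry)
open import Data.Sum using (_⊎_; inj₁; inj₂)
open import Data.Vec using (Vec; map; sum)
open import Data.Vec.Relation.Unary.All using (All)
open import Level using (Level; 0ℓ; suc)
open import Relation.Binary using (Rel; Decidable; Symmetric; Irreflexive)
open import Relation.Binary.PropositionalEquality using (_≡_; _≢_; refl; sym; trans)
open import Relation.Nullary using (¬_; Dec; yes; no; ¬?; _×-dec_; _⊎-dec_)
open import Relation.Unary using (Pred)

record Graph (n : ℕ) : Set₁ where
  field
    Adj        : Rel (Fin n) 0ℓ
    adj?       : Decidable Adj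
    adj-sym    : Symmetric Adj
    adj-irrefl : Irreflexive _≡_ Adj

open Graph public

-- Adjacency is irreflexive, so the three vertices are automatically distinct.
HasTriangle : ∀ {n} → Graph n → Set
HasTriangle G = ∃[ x ] ∃[ y ] ∃[ z ] (Adj G x y × Adj G y z × Adj G x z)

hasTriangle? : ∀ {n} (G : Graph n) → Dec (HasTriangle G)
hasTriangle? G =
  any? λ x → any? λ y → any? λ z → adj? G x y ×-dec adj? G y z ×-dec adj? G x z

TriangleFree : ∀ {n} → Graph n → Set
TriangleFree G = ¬ HasTriangle G

addEdge : ∀ {n} → Graph n → {x y : Fin n} → x ≢ y → Graph n
addEdge G {x} {y} x≢y = record
  { Adj        = λ u v → Adj G u v ⊎ (u ≡ x × v ≡ y) ⊎ (u ≡ y × v ≡ x)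
  ; adj?       = λ u v → adj? G u v ⊎-dec ((u ≟ x ×-dec v ≟ y) ⊎-dec (u ≟ y ×-dec v ≟ x))
  ; adj-sym    = λ where
      (inj₁ e)               → inj₁ (adj-sym G e)
      (inj₂ (inj₁ (p , q)))  → inj₂ (inj₂ (q , p))
      (inj₂ (inj₂ (p , q)))  → inj₂ (inj₁ (q , p))
  ; adj-irrefl = λ where
      refl (inj₁ e)              → adj-irrefl G refl e
      refl (inj₂ (inj₁ (p , q))) → x≢y (trans (sym p) q)
      refl (inj₂ (inj₂ (p , q))) → x≢y (trans (sym q) p)
  }

TriangleSaturating : ∀ {n} → Graph n → Rel (Fin n) 0ℓ
TriangleSaturating G x y =
  Σ[ x≢y ∈ x ≢ y ] (¬ Adj G x y × HasTriangle (addEdge G x≢y))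

triangleSaturating? : ∀ {n} (G : Graph n) → Decidable (TriangleSaturating G)
triangleSaturating? G x y with x ≟ y
... | yes x≡y = no λ (x≢y , _) → x≢y x≡y
... | no  x≢y with ¬? (adj? G x y) ×-dec hasTriangle? (addEdge G x≢y)
...   | yes p = yes (x≢y , p)
...   | no ¬p = no λ (_ , p) → ¬p p

-- Each unordered pair of distinct vertices is listed once, smaller vertex first.
vertexPairs : ∀ n → List (Fin n × Fin n)
vertexPairs n = filter (uncurry _<?_) (cartesianProduct (allFin n) (allFin n))

edgeCount : ∀ {n} → Graph n → ℕ
edgeCount {n} G = length (filter (uncurry (adj? G)) (vertexPairs n))

f₃ : ∀ {n} → Graph n → ℕ
f₃ {n} G = length (filter (uncurry (triangleSaturating? G)) (vertexPairs n))

t : ℕ → ℕ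
t q = q ^ 2 / 4

s : ℕ → ℕ
s q = (q ∸ 1) ^ 2 / 4

IsMinimum : ∀ {ℓ : Level} → Pred ℕ ℓ → Pred ℕ ℓ
IsMinimum P v = P v × (∀ w → P w → v ≤ w)

f₃-Values : ℕ → ℕ → Pred ℕ (suc 0ℓ)
f₃-Values n m v =
  Σ[ G ∈ Graph n ] (TriangleFree G × edgeCount G ≡ m × f₃ G ≡ v)

Partition-Values : ℕ → ℕ → Pred ℕ 0ℓ
Partition-Values n m v =
  ∃[ k ] Σ[ q ∈ Vec ℕ k ]
    (k ≥ 1 × All (_≥ 1) q × sum q ≡ n × sum (map t q) ≥ m × sum (map s q) ≡ v)

{-# OPTIONS --safe #-}
-- Lower bound. The saturating pairs of G are the pairs at distance two. Such pairs and the edges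
-- inside a connected component S number h and e, and we show that either e ≤ h + 1 or S is
-- bipartite with all pairs on each side at distance two. Remove a vertex v that does not
-- disconnect S and has at least as many vertices at distance two as neighbours: if e ≤ h + 1 held
-- before adding v back, it persists, and if S ∖ v was of the bipartite kind, then a count of the
-- edges missing between the two sides decides. If no such v exists, then S is complete bipartite.
-- In both cases a single part q ≤ |S| has t(q) ≥ e and s(q) ≤ h, since s(q + 1) = t(q) and
-- e + h ≤ |S|(|S| - 1)/2; fill up with parts 1.
-- Upper bound. Delete edges from the disjoint union of balanced complete bipartite graphs.
module Submission where

open import Defs
open import Data.Bool as Bool using (Bool; true; false)
open import Data.Empty using (⊥)
open import Data.Fin using (Fin; _<?_) renaming (_<_ to _<ᶠ_; _≟_ to _≟ᶠ_)
import Data.Fin.Properties as Fin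
open import Data.List
  using (List; []; _∷_; _++_; length; filter; map; replicate; lookup; allFin; cartesianProduct)
open import Data.List.Extrema.Nat using (argmin; argmin-all; f[argmin]≤f[xs])
import Data.List.Membership.DecPropositional as DecMembership
open import Data.List.Membership.Propositional using (_∈_; _∉_; find; lose)
open import Data.List.Membership.Propositional.Properties
  using (∈-∃++; ∈-++⁻; ∈-++⁺ˡ; ∈-++⁺ʳ; ∈-filter⁺; ∈-filter⁻; ∈-map⁺)
open import Data.List.Properties
  using (filter-accept; filter-all; filter-none; filter-notAll; filter-reject; filter-some; filter-++;
         length-filter; length-++; length-replicate; length-tabulate; map-tabulate; tabulate-lookup;
         ++-identityʳ)
open import Data.List.Relation.Binary.Permutation.Propositional
  using (_↭_; prep; swap; ↭-refl; ↭-sym; ↭-trans; ↭⇒↭ₛ) renaming (refl to ↭refl; trans to ↭trans)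
open import Data.List.Relation.Binary.Permutation.Propositional.Properties
  using (Any-resp-↭; filter-↭; shift; ∈-resp-↭; ↭-length; ++-comm; ++⁺ˡ)
open import Data.List.Relation.Binary.Permutation.Setoid.Properties using (Unique-resp-↭)
open import Data.List.Relation.Unary.All as All using (All; []; _∷_; all?)
open import Data.List.Relation.Unary.All.Properties using (all-filter; replicate⁺; ¬All⇒Any¬; ++⁻ˡ)
open import Data.List.Relation.Unary.AllPairs as AllPairs using (AllPairs; []; _∷_)
open import Data.List.Relation.Unary.AllPairs.Properties using (tabulate⁺-<)
open import Data.List.Relation.Unary.Any using (Any; here; there; any?; tail)
open import Data.List.Relation.Unary.Unique.Propositional using (Unique)
open import Data.List.Relation.Unary.Unique.Propositional.Properties
  using (allFin⁺; cartesianProduct⁺; filter⁺; Unique[x∷xs]⇒x∉xs)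
open import Data.Nat
  using (ℕ; zero; suc; _+_; _*_; _∸_; _^_; _/_; _≤_; _<_; _≥_; _≟_; _≤?_; _≥?_; z≤n; s≤s; s≤s⁻¹;
         ⌊_/2⌋; ⌈_/2⌉)
open import Data.Nat.DivMod using (m<n*o⇒m/o<n; m*n/n≡m; /-monoˡ-≤)
open import Data.Nat.ListAction using (sum)
open import Data.Nat.Properties hiding (_≟_; _≤?_; _≥?_; _<?_)
open import Data.Nat.Tactic.RingSolver using (solve-∀)
open import Data.Product using (∃; ∃-syntax; Σ-syntax; _×_; _,_; proj₁; proj₂; uncurry)
open import Data.Product.Properties using (≡-dec)
open import Data.Sum using (_⊎_; inj₁; inj₂; [_,_]′)
open import Data.Vec as Vec using (Vec; []; _∷_)
open import Data.Vec.Relation.Unary.All as VecAll using ([]; _∷_)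
open import Function using (_∘_; id)
open import Level using (0ℓ)
open import Relation.Binary using (Rel; Symmetric; DecidableEquality) renaming (Decidable to Decidable₂)
open import Relation.Binary.PropositionalEquality
  using (_≡_; _≢_; refl; sym; trans; cong; cong₂; subst; subst₂; setoid; module ≡-Reasoning)
open import Relation.Nullary using (¬_; Dec; yes; no; ¬?; contradiction; _×-dec_; _⊎-dec_; _→-dec_)
open import Relation.Nullary.Decidable using (decidable-stable)
open import Relation.Unary using (Pred; Decidable)

-- Quadratic inequalities and estimates for `t` and `s`.

2ab≤a²+b² : ∀ a b → 2 * (a * b) ≤ a * a + b * b
2ab≤a²+b² a b with ≤-total a b
... | inj₁ a≤b with c , refl ← m≤n⇒∃[o]m+o≡n a≤b = subst (2 * (a * (a + c)) ≤_) (eq a c) (m≤m+n _ (c * c))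
  where
  eq : ∀ a c → 2 * (a * (a + c)) + c * c ≡ a * a + (a + c) * (a + c)
  eq = solve-∀
... | inj₂ b≤a with c , refl ← m≤n⇒∃[o]m+o≡n b≤a = subst (2 * ((b + c) * b) ≤_) (eq b c) (m≤m+n _ (c * c))
  where
  eq : ∀ b c → 2 * ((b + c) * b) + c * c ≡ (b + c) * (b + c) + b * b
  eq = solve-∀

-- In terms of x = a - b this says 0 ≤ x² - x.
2ab+a≤a²+b²+b : ∀ a b → 2 * (a * b) + a ≤ a * a + b * b + b
2ab+a≤a²+b²+b a b with a ≤? b
... | yes a≤b = +-mono-≤ (2ab≤a²+b² a b) a≤b
... | no  a≰b with c , refl ← m≤n⇒∃[o]m+o≡n (≰⇒> a≰b) =
  subst (2 * ((suc b + c) * b) + (suc b + c) ≤_) (eq b c) (m≤m+n _ (c * c + c))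
  where
  eq : ∀ b c → 2 * ((suc b + c) * b) + (suc b + c) + (c * c + c) ≡ (suc b + c) * (suc b + c) + b * b + b
  eq = solve-∀

-- α and β stand for the binomials (a choose 2) and (b choose 2).
halve : ∀ a b α β c d → a + 2 * α ≡ a * a → b + 2 * β ≡ b * b →
        2 * c + (a + b) ≤ a * a + b * b + 2 * d → c ≤ d + (α + β)
halve a b α β c d α≡ β≡ le = *-cancelˡ-≤ 2 (+-cancelʳ-≤ (a + b) _ _ (begin
  2 * c + (a + b)                        ≤⟨ le ⟩
  a * a + b * b + 2 * d                  ≡⟨ cong₂ (λ m n → m + n + 2 * d) α≡ β≡ ⟨
  a + 2 * α + (b + 2 * β) + 2 * d        ≡⟨ eq a b α β d ⟩
  2 * (d + (α + β)) + (a + b)            ∎))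
  where
  open ≤-Reasoning
  eq : ∀ a b α β d → a + 2 * α + (b + 2 * β) + 2 * d ≡ 2 * (d + (α + β)) + (a + b)
  eq = solve-∀

-- Meant for a vertex with `i` neighbours, `κ` `H`-partners and `p` other vertices in a clique of
-- size `a`, and with none, `l` and `r` of these in a clique of size `b`. The bound on `c` equals
-- `ab - ir`. After doubling, `2ab + a ≤ a² + b² + b` leaves the slack `2(i-1)(r-1) + 2κ`, which is
-- nonnegative.
one-sided : ∀ i κ p l r {c} α β → 1 ≤ i → 1 ≤ r →
  (i + κ + p) + 2 * α ≡ (i + κ + p) * (i + κ + p) →
  (l + r) + 2 * β ≡ (l + r) * (l + r) →
  c ≤ i * l + κ * (l + r) + p * (l + r) →
  i + c ≤ suc (κ + l) + (α + β)
one-sided i@(suc i′) κ p l r@(suc r′) {c} α β (s≤s _) (s≤s _) α≡ β≡ c≤ =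
  halve a b α β (i + c) (suc (κ + l)) α≡ β≡ (+-cancelʳ-≤ (2 * (i * r)) _ _ (begin
    2 * (i + c) + (a + b) + 2 * (i * r)           ≤⟨ +-monoˡ-≤ (2 * (i * r)) (+-monoˡ-≤ (a + b) (*-monoʳ-≤ 2 (+-monoʳ-≤ i c≤))) ⟩
    2 * (i + (i * l + κ * (l + r) + p * (l + r))) + (a + b) + 2 * (i * r) ≡⟨ eq₁ i κ p l r ⟩
    2 * (a * b) + a + (2 * i + b)                 ≤⟨ +-monoˡ-≤ (2 * i + b) (2ab+a≤a²+b²+b a b) ⟩
    a * a + b * b + b + (2 * i + b)               ≤⟨ m≤m+n _ (2 * (i′ * r′) + 2 * κ) ⟩
    a * a + b * b + b + (2 * i + b) + (2 * (i′ * r′) + 2 * κ) ≡⟨ eq₂ (a * a) (b * b) i′ κ l r′ ⟩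
    a * a + b * b + 2 * suc (κ + l) + 2 * (i * r) ∎))
  where
  open ≤-Reasoning
  a = i + κ + p
  b = l + r
  eq₁ : ∀ i κ p l r → 2 * (i + (i * l + κ * (l + r) + p * (l + r))) + (i + κ + p + (l + r)) + 2 * (i * r)
      ≡ 2 * ((i + κ + p) * (l + r)) + (i + κ + p) + (2 * i + (l + r))
  eq₁ = solve-∀
  eq₂ : ∀ A B i κ l r → A + B + (l + suc r) + (2 * suc i + (l + suc r)) + (2 * (i * r) + 2 * κ)
      ≡ A + B + 2 * suc (κ + l) + 2 * (suc i * suc r)
  eq₂ = solve-∀

-- The same situation with `j` neighbours in the second clique. The bound on `c` equals
-- `ab - ij - ir - pj`. After `2ab ≤ a² + b²` and `i + j ≤ κ + l` have been used, the remaining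
-- slack is `2(i-1)(j-1) + r(2i-1) + p(2j-1)`.
two-sided : ∀ i κ p j l r {c} α β → 1 ≤ i → 1 ≤ j → i + j ≤ κ + l →
  (i + κ + p) + 2 * α ≡ (i + κ + p) * (i + κ + p) →
  (j + l + r) + 2 * β ≡ (j + l + r) * (j + l + r) →
  c ≤ i * l + κ * (j + l + r) + p * (l + r) →
  i + j + c ≤ suc (κ + l) + (α + β)
two-sided i@(suc i′) κ p j@(suc j′) l r {c} α β (s≤s _) (s≤s _) d≤k α≡ β≡ c≤ =
  halve a b α β (i + j + c) (suc (κ + l)) α≡ β≡ (+-cancelʳ-≤ m _ _ (begin
    2 * (i + j + c) + (a + b) + m        ≤⟨ +-monoˡ-≤ m (+-monoˡ-≤ (a + b) (*-monoʳ-≤ 2 (+-monoʳ-≤ (i + j) c≤))) ⟩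
    2 * (i + j + (i * l + κ * (j + l + r) + p * (l + r))) + (a + b) + m ≡⟨ eq₁ i κ p j l r ⟩
    2 * (a * b) + ((i + j) + (2 * (i + j) + κ + l + p + r)) ≤⟨ +-mono-≤ (2ab≤a²+b² a b) (+-monoˡ-≤ _ d≤k) ⟩
    a * a + b * b + ((κ + l) + (2 * (i + j) + κ + l + p + r)) ≤⟨ m≤m+n _ e ⟩
    a * a + b * b + ((κ + l) + (2 * (i + j) + κ + l + p + r)) + e ≡⟨ eq₂ (a * a) (b * b) i′ κ p j′ l r ⟩
    a * a + b * b + 2 * suc (κ + l) + m  ∎))
  where
  open ≤-Reasoning
  a = i + κ + p
  b = j + l + r
  m = 2 * (i * j) + 2 * (i * r) + 2 * (p * j)
  e = 2 * (i′ * j′) + (r + 2 * (i′ * r)) + (p + 2 * (p * j′))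
  eq₁ : ∀ i κ p j l r →
    2 * (i + j + (i * l + κ * (j + l + r) + p * (l + r))) + (i + κ + p + (j + l + r)) + (2 * (i * j) + 2 * (i * r) + 2 * (p * j))
    ≡ 2 * ((i + κ + p) * (j + l + r)) + ((i + j) + (2 * (i + j) + κ + l + p + r))
  eq₁ = solve-∀
  eq₂ : ∀ A B i κ p j l r →
    A + B + ((κ + l) + (2 * (suc i + suc j) + κ + l + p + r)) + (2 * (i * j) + (r + 2 * (i * r)) + (p + 2 * (p * j)))
    ≡ A + B + 2 * suc (κ + l) + (2 * (suc i * suc j) + 2 * (suc i * r) + 2 * (p * suc j))
  eq₂ = solve-∀

x^2≡x*x : ∀ x → x ^ 2 ≡ x * x
x^2≡x*x x = cong (x *_) (*-identityʳ x)

≤t : ∀ {e} q → e * 4 ≤ q * q → e ≤ t q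
≤t {e} q le = begin
  e            ≡⟨ m*n/n≡m e 4 ⟨
  e * 4 / 4    ≤⟨ /-monoˡ-≤ 4 (≤-trans le (≤-reflexive (sym (x^2≡x*x q)))) ⟩
  q ^ 2 / 4    ∎
  where open ≤-Reasoning

t≤ : ∀ {e} q → q * q < suc e * 4 → t q ≤ e
t≤ {e} q lt = s≤s⁻¹ (m<n*o⇒m/o<n (subst (_< suc e * 4) (sym (x^2≡x*x q)) lt))

ab≤t[a+b] : ∀ a b → a * b ≤ t (a + b)
ab≤t[a+b] a b = ≤t (a + b) (begin
  a * b * 4                          ≡⟨ eq₁ a b ⟩
  2 * (a * b) + 2 * (a * b)          ≤⟨ +-monoˡ-≤ _ (2ab≤a²+b² a b) ⟩
  a * a + b * b + 2 * (a * b)        ≡⟨ eq₂ a b ⟩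
  (a + b) * (a + b)                  ∎)
  where
  open ≤-Reasoning
  eq₁ : ∀ a b → a * b * 4 ≡ 2 * (a * b) + 2 * (a * b)
  eq₁ = solve-∀
  eq₂ : ∀ a b → a * a + b * b + 2 * (a * b) ≡ (a + b) * (a + b)
  eq₂ = solve-∀

-- With `q = a + b`, the inequality `2(a² + b²) ≥ q²` gives `4(α + β) ≥ (q-1)² - 1`, and the
-- rounding in `s` absorbs the 1. The case `q = 0` is separate because `s` truncates `q - 1`.
s[a+b]≤ : ∀ a b α β → a + 2 * α ≡ a * a → b + 2 * β ≡ b * b → s (a + b) ≤ α + β
s[a+b]≤ a b α β α≡ β≡ = bound (a + b) refl
  where
  open ≤-Reasoning
  eq₁ : ∀ n → suc (n * n) + 2 * suc n ≡ 2 + suc n * suc n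
  eq₁ = solve-∀
  eq₂ : ∀ a b → 2 + (a + b) * (a + b) ≡ 2 * (a * b) + (a * a + b * b + 2)
  eq₂ = solve-∀
  eq₃ : ∀ a b α β → a + 2 * α + (b + 2 * β) + (a + 2 * α + (b + 2 * β) + 2) + 2 ≡ suc (α + β) * 4 + 2 * (a + b)
  eq₃ = solve-∀
  bound : ∀ q → a + b ≡ q → s q ≤ α + β
  bound zero    _   = z≤n
  bound (suc n) a+b = t≤ n (+-cancelʳ-≤ (2 * suc n) _ _ (begin
    suc (n * n) + 2 * suc n                    ≡⟨ eq₁ n ⟩
    2 + suc n * suc n                          ≡⟨ cong (λ q → 2 + q * q) a+b ⟨
    2 + (a + b) * (a + b)                      ≡⟨ eq₂ a b ⟩
    2 * (a * b) + (a * a + b * b + 2)          ≤⟨ +-monoˡ-≤ _ (2ab≤a²+b² a b) ⟩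
    a * a + b * b + (a * a + b * b + 2)        ≤⟨ m≤m+n _ 2 ⟩
    a * a + b * b + (a * a + b * b + 2) + 2    ≡⟨ cong₂ (λ x y → x + y + (x + y + 2) + 2) α≡ β≡ ⟨
    a + 2 * α + (b + 2 * β) + (a + 2 * α + (b + 2 * β) + 2) + 2 ≡⟨ eq₃ a b α β ⟩
    suc (α + β) * 4 + 2 * (a + b)              ≡⟨ cong (λ q → suc (α + β) * 4 + 2 * q) a+b ⟩
    suc (α + β) * 4 + 2 * suc n                ∎))

⌈n/2⌉≡⌊n/2⌋+[0,1] : ∀ n → ⌈ n /2⌉ ≡ ⌊ n /2⌋ ⊎ ⌈ n /2⌉ ≡ suc ⌊ n /2⌋
⌈n/2⌉≡⌊n/2⌋+[0,1] zero          = inj₁ refl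
⌈n/2⌉≡⌊n/2⌋+[0,1] (suc zero)    = inj₂ refl
⌈n/2⌉≡⌊n/2⌋+[0,1] (suc (suc n)) with ⌈n/2⌉≡⌊n/2⌋+[0,1] n
... | inj₁ eq = inj₁ (cong suc eq)
... | inj₂ eq = inj₂ (cong suc eq)

t[a+b]≤ab : ∀ a b → b ≡ a ⊎ b ≡ suc a → t (a + b) ≤ a * b
t[a+b]≤ab a .a       (inj₁ refl) = t≤ (a + a) (subst ((a + a) * (a + a) <_) (eq a) (m≤m+n _ 3))
  where
  eq : ∀ a → suc ((a + a) * (a + a)) + 3 ≡ suc (a * a) * 4
  eq = solve-∀
t[a+b]≤ab a .(suc a) (inj₂ refl) = t≤ (a + suc a) (subst ((a + suc a) * (a + suc a) <_) (eq a) (m≤m+n _ 2))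
  where
  eq : ∀ a → suc ((a + suc a) * (a + suc a)) + 2 ≡ suc (a * suc a) * 4
  eq = solve-∀

2a²+2b²≤[a+b]²+1 : ∀ a b → b ≡ a ⊎ b ≡ suc a → 2 * (a * a + b * b) ≤ (a + b) * (a + b) + 1
2a²+2b²≤[a+b]²+1 a .a       (inj₁ refl) = subst (_≤ (a + a) * (a + a) + 1) (eq a) (m≤m+n _ 1)
  where
  eq : ∀ a → (a + a) * (a + a) ≡ 2 * (a * a + a * a)
  eq = solve-∀
2a²+2b²≤[a+b]²+1 a .(suc a) (inj₂ refl) = ≤-reflexive (eq a)
  where
  eq : ∀ a → 2 * (a * a + suc a * suc a) ≡ (a + suc a) * (a + suc a) + 1
  eq = solve-∀

-- Balanced sides attain the bound of `s[a+b]≤`: there `2(a² + b²)` exceeds `q²` by at most 1, so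
-- `4(α + β) ≤ (q-1)²` for `q = a + b`.
≤s[a+b] : ∀ a b α β → b ≡ a ⊎ b ≡ suc a → a + 2 * α ≡ a * a → b + 2 * β ≡ b * b → α + β ≤ s (a + b)
≤s[a+b] a b α β near α≡ β≡ = bound (a + b) refl
  where
  open ≤-Reasoning
  eq₁ : ∀ a b α β → (α + β) * 4 + 2 * (a + b) ≡ 2 * (a + 2 * α + (b + 2 * β))
  eq₁ = solve-∀
  eq₂ : ∀ n → suc n * suc n + 1 ≡ n * n + 2 * suc n
  eq₂ = solve-∀
  square : (α + β) * 4 + 2 * (a + b) ≤ (a + b) * (a + b) + 1
  square = begin
    (α + β) * 4 + 2 * (a + b)        ≡⟨ eq₁ a b α β ⟩
    2 * (a + 2 * α + (b + 2 * β))    ≡⟨ cong₂ (λ x y → 2 * (x + y)) α≡ β≡ ⟩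
    2 * (a * a + b * b)              ≤⟨ 2a²+2b²≤[a+b]²+1 a b near ⟩
    (a + b) * (a + b) + 1            ∎
  bound : ∀ q → a + b ≡ q → α + β ≤ s q
  bound zero    a+b = vanish (α + β) (subst (λ q → (α + β) * 4 + 2 * q ≤ q * q + 1) a+b square)
    where
    vanish : ∀ γ → γ * 4 + 0 ≤ 1 → γ ≤ 0
    vanish zero    _ = z≤n
    vanish (suc γ) (s≤s ())
  bound (suc n) a+b = ≤t n (+-cancelʳ-≤ (2 * suc n) _ _
    (subst ((α + β) * 4 + 2 * suc n ≤_) (eq₂ n) (subst (λ q → (α + β) * 4 + 2 * q ≤ q * q + 1) a+b square)))

-- Counting elements and pairs in lists.

module _ {A : Set} {P : Pred A 0ℓ} (P? : Decidable P) where

  # : List A → ℕ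
  # xs = length (filter P? xs)

  #-yes : ∀ {x} xs → P x → # (x ∷ xs) ≡ suc (# xs)
  #-yes xs px = cong length (filter-accept P? {xs = xs} px)

  #-no : ∀ {x} xs → ¬ P x → # (x ∷ xs) ≡ # xs
  #-no xs ¬px = cong length (filter-reject P? {xs = xs} ¬px)

  #-++ : ∀ xs ys → # (xs ++ ys) ≡ # xs + # ys
  #-++ xs ys = trans (cong length (filter-++ P? xs ys)) (length-++ (filter P? xs))

  #-↭ : ∀ {xs ys} → xs ↭ ys → # xs ≡ # ys
  #-↭ = ↭-length ∘ filter-↭ P?

#-mono : ∀ {A : Set} {P Q : Pred A 0ℓ} (P? : Decidable P) (Q? : Decidable Q) xs →
         (∀ {x} → x ∈ xs → P x → Q x) → # P? xs ≤ # Q? xs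
#-mono P? Q? []       P⇒Q = z≤n
#-mono P? Q? (x ∷ xs) P⇒Q with #-mono P? Q? xs (P⇒Q ∘ there) | P? x | Q? x
... | ih | yes p | yes q = s≤s ih
... | ih | yes p | no ¬q = contradiction (P⇒Q (here refl) p) ¬q
... | ih | no ¬p | yes q = m≤n⇒m≤1+n ih
... | ih | no ¬p | no ¬q = ih

#-cong : ∀ {A : Set} {P Q : Pred A 0ℓ} (P? : Decidable P) (Q? : Decidable Q) xs →
         (∀ {x} → x ∈ xs → P x → Q x) → (∀ {x} → x ∈ xs → Q x → P x) →
         # P? xs ≡ # Q? xs
#-cong P? Q? xs P⇒Q Q⇒P = ≤-antisym (#-mono P? Q? xs P⇒Q) (#-mono Q? P? xs Q⇒P)

-- An element satisfying `Q` but not `P` would make the count of `P` strictly smaller. This turns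
-- equal degrees into equal neighbourhoods.
#-mono⁻ : ∀ {A : Set} {P Q : Pred A 0ℓ} (P? : Decidable P) (Q? : Decidable Q) xs →
          (∀ {x} → x ∈ xs → P x → Q x) → # Q? xs ≤ # P? xs →
          ∀ {x} → x ∈ xs → Q x → P x
#-mono⁻ P? Q? (x ∷ xs) P⇒Q Q≤P x∈ qx
  with #-mono P? Q? xs (P⇒Q ∘ there) | #-mono⁻ P? Q? xs (P⇒Q ∘ there) | P? x | Q? x
#-mono⁻ P? Q? (x ∷ xs) P⇒Q Q≤P (here refl) qx | _ | _  | yes p | _     = p
#-mono⁻ P? Q? (x ∷ xs) P⇒Q Q≤P (here refl) qx | _ | _  | no _  | no ¬q = contradiction qx ¬q
#-mono⁻ P? Q? (x ∷ xs) P⇒Q Q≤P (here refl) qx | m | _  | no _  | yes _ = contradiction m (<⇒≱ Q≤P)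
#-mono⁻ P? Q? (x ∷ xs) P⇒Q Q≤P (there x∈)  qx | _ | ih | yes p | yes q = ih (s≤s⁻¹ Q≤P) x∈ qx
#-mono⁻ P? Q? (x ∷ xs) P⇒Q Q≤P (there x∈)  qx | _ | ih | yes p | no ¬q = contradiction (P⇒Q (here refl) p) ¬q
#-mono⁻ P? Q? (x ∷ xs) P⇒Q Q≤P (there x∈)  qx | _ | ih | no _  | yes _ = ih (≤-trans (n≤1+n _) Q≤P) x∈ qx
#-mono⁻ P? Q? (x ∷ xs) P⇒Q Q≤P (there x∈)  qx | _ | ih | no _  | no _  = ih Q≤P x∈ qx

-- The partner of the first element is deleted from `ys`. By `inj` and uniqueness no later element
-- has that partner, so the induction continues with the shorter list.
pigeonhole : ∀ {A B : Set} (R : A → B → Set) → (∀ {x x′ y} → R x y → R x′ y → x ≡ x′) →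
             ∀ {xs} → Unique xs → ∀ ys → (∀ {x} → x ∈ xs → ∃[ y ] y ∈ ys × R x y) →
             length xs ≤ length ys
pigeonhole R inj []                 ys f = z≤n
pigeonhole R inj (x∉xs ∷ u) ys f
  with y , y∈ys , r ← f (here refl) with as , bs , refl ← ∈-∃++ y∈ys =
  subst (_ ≤_) (sym (↭-length (shift y as bs))) (s≤s (pigeonhole R inj u (as ++ bs) avoid))
  where
  avoid : ∀ {x} → x ∈ _ → ∃[ z ] z ∈ as ++ bs × R x z
  avoid x∈ with z , z∈ , r′ ← f (there x∈) with ∈-++⁻ as z∈
  ... | inj₁ z∈as          = z , ∈-++⁺ˡ z∈as , r′
  ... | inj₂ (there z∈bs)  = z , ∈-++⁺ʳ as z∈bs , r′
  ... | inj₂ (here refl)   = contradiction (inj r r′) (All.lookup x∉xs x∈)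

pairs : ∀ {A : Set} {R : Rel A 0ℓ} → Decidable₂ R → List A → ℕ
pairs R? []       = 0
pairs R? (x ∷ xs) = # (R? x) xs + pairs R? xs

cross : ∀ {A : Set} {R : Rel A 0ℓ} → Decidable₂ R → List A → List A → ℕ
cross R? xs ys = sum (map (λ x → # (R? x) ys) xs)

pairs-++ : ∀ {A : Set} {R : Rel A 0ℓ} (R? : Decidable₂ R) xs ys →
           pairs R? (xs ++ ys) ≡ cross R? xs ys + (pairs R? xs + pairs R? ys)
pairs-++ R? []       ys = refl
pairs-++ R? (x ∷ xs) ys rewrite #-++ (R? x) xs ys | pairs-++ R? xs ys =
  rearrange (# (R? x) xs) (# (R? x) ys) (cross R? xs ys) (pairs R? xs) (pairs R? ys)
  where
  rearrange : ∀ p q c e f → p + q + (c + (e + f)) ≡ q + c + (p + e + f)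
  rearrange = solve-∀

exchange : ∀ m n o → m + (n + o) ≡ n + (m + o)
exchange = solve-∀

pairs-↭ : ∀ {A : Set} {R : Rel A 0ℓ} (R? : Decidable₂ R) → Symmetric R → ∀ {xs ys} → xs ↭ ys → pairs R? xs ≡ pairs R? ys
pairs-↭ R? R-sym ↭refl         = refl
pairs-↭ R? R-sym (prep x p)    = cong₂ _+_ (#-↭ (R? x) p) (pairs-↭ R? R-sym p)
pairs-↭ R? R-sym (↭trans p q)  = trans (pairs-↭ R? R-sym p) (pairs-↭ R? R-sym q)
pairs-↭ R? R-sym (swap {xs} {ys} x y p)
  with #-↭ (R? x) p | #-↭ (R? y) p | pairs-↭ R? R-sym p | R? x y | R? y x
... | ex | ey | e | yes _ | yes _ rewrite ex | ey | e =
  cong suc (exchange (# (R? x) ys) (# (R? y) ys) (pairs R? ys))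
... | ex | ey | e | no _  | no _  rewrite ex | ey | e =
  exchange (# (R? x) ys) (# (R? y) ys) (pairs R? ys)
... | _  | _  | _ | yes r | no ¬r = contradiction (R-sym r) ¬r
... | _  | _  | _ | no ¬r | yes r = contradiction (R-sym r) ¬r

pairs-none : ∀ {A : Set} {R : Rel A 0ℓ} (R? : Decidable₂ R) {xs} → AllPairs (λ x y → ¬ R x y) xs → pairs R? xs ≡ 0
pairs-none R? [] = refl
pairs-none R? (_∷_ {xs = xs} ¬r ¬rs)
  rewrite filter-none (R? _) ¬r = pairs-none R? ¬rs

-- The count is the binomial `(l choose 2)` for `l = length xs`, written without subtraction or
-- division.
pairs-all : ∀ {A : Set} {R : Rel A 0ℓ} (R? : Decidable₂ R) {xs} → AllPairs R xs →
            length xs + 2 * pairs R? xs ≡ length xs * length xs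
pairs-all R? [] = refl
pairs-all R? (_∷_ {xs = xs} r rs)
  rewrite filter-all (R? _) r = begin
    suc (l + 2 * (l + p))      ≡⟨ rearrange l p ⟩
    suc (l + l + (l + 2 * p))  ≡⟨ cong (λ z → suc (l + l + z)) (pairs-all R? rs) ⟩
    suc (l + l + l * l)        ≡⟨ rearrange′ l ⟩
    suc l * suc l              ∎
  where
  open ≡-Reasoning
  l = length xs
  p = pairs R? xs
  rearrange : ∀ l p → suc (l + 2 * (l + p)) ≡ suc (l + l + (l + 2 * p))
  rearrange = solve-∀
  rearrange′ : ∀ l → suc (l + l + l * l) ≡ suc l * suc l
  rearrange′ = solve-∀

cross-none : ∀ {A : Set} {R : Rel A 0ℓ} (R? : Decidable₂ R) xs {ys} → (∀ {x y} → x ∈ xs → y ∈ ys → ¬ R x y) →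
             cross R? xs ys ≡ 0
cross-none R? []       ¬r = refl
cross-none R? (x ∷ xs) ¬r =
  cong₂ _+_ (cong length (filter-none (R? x) (All.tabulate (¬r (here refl)))))
            (cross-none R? xs (¬r ∘ there))

cross-all : ∀ {A : Set} {R : Rel A 0ℓ} (R? : Decidable₂ R) xs {ys} → (∀ {x y} → x ∈ xs → y ∈ ys → R x y) →
            cross R? xs ys ≡ length xs * length ys
cross-all R? []       r = refl
cross-all R? (x ∷ xs) r =
  cong₂ _+_ (cong length (filter-all (R? x) (All.tabulate (r (here refl)))))
            (cross-all R? xs (r ∘ there))

cross-≤ : ∀ {A : Set} {R : Rel A 0ℓ} (R? : Decidable₂ R) xs ys → cross R? xs ys ≤ length xs * length ys
cross-≤ R? []       ys = z≤n
cross-≤ R? (x ∷ xs) ys = +-mono-≤ (length-filter (R? x) ys) (cross-≤ R? xs ys)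

#-map : ∀ {A B : Set} {P : Pred B 0ℓ} (P? : Decidable P) (f : A → B) xs →
        # P? (map f xs) ≡ # (P? ∘ f) xs
#-map P? f []       = refl
#-map P? f (x ∷ xs) with P? (f x)
... | yes _ = cong suc (#-map P? f xs)
... | no  _ = #-map P? f xs

#-filter : ∀ {A : Set} {P Q : Pred A 0ℓ} (P? : Decidable P) (Q? : Decidable Q) xs →
           # P? (filter Q? xs) ≡ # (λ x → Q? x ×-dec P? x) xs
#-filter P? Q? []       = refl
#-filter P? Q? (x ∷ xs) with Q? x
... | no  _ = #-filter P? Q? xs
... | yes _ with P? x
...   | yes _ = cong suc (#-filter P? Q? xs)
...   | no  _ = #-filter P? Q? xs

pairs-map : ∀ {A B : Set} {R : Rel B 0ℓ} (R? : Decidable₂ R) (f : A → B) xs →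
            pairs R? (map f xs) ≡ pairs (λ x y → R? (f x) (f y)) xs
pairs-map R? f []       = refl
pairs-map R? f (x ∷ xs) = cong₂ _+_ (#-map (R? (f x)) f xs) (pairs-map R? f xs)

pairs-mono : ∀ {A : Set} {R R′ : Rel A 0ℓ} (R? : Decidable₂ R) (R′? : Decidable₂ R′) xs →
             (∀ {x y} → R x y → R′ x y) → pairs R? xs ≤ pairs R′? xs
pairs-mono R? R′? []       R⇒R′ = z≤n
pairs-mono R? R′? (x ∷ xs) R⇒R′ = +-mono-≤ (#-mono (R? x) (R′? x) xs (λ _ → R⇒R′)) (pairs-mono R? R′? xs R⇒R′)

-- A relaxation of `Partition-Values`: the cost is only bounded above, and `k = 0` is allowed, so
-- that partitions can be built component by component from the empty one.
Dominated : ℕ → ℕ → ℕ → Set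
Dominated n m v = ∃[ k ] Σ[ q ∈ Vec ℕ k ]
  (VecAll.All (_≥ 1) q × Vec.sum q ≡ n × m ≤ Vec.sum (Vec.map t q) × Vec.sum (Vec.map s q) ≤ v)

Dominated-resp : ∀ {n n′ m m′ v v′} → n ≡ n′ → m′ ≤ m → v ≤ v′ → Dominated n m v → Dominated n′ m′ v′
Dominated-resp refl m′≤m v≤v′ (k , q , q≥1 , Σq , m≤ , ≤v) =
  k , q , q≥1 , Σq , ≤-trans m′≤m m≤ , ≤-trans ≤v v≤v′

add-part : ∀ {p n m v} → p ≥ 1 → Dominated n m v → Dominated (p + n) (t p + m) (s p + v)
add-part {p} p≥1 (k , q , q≥1 , refl , m≤ , ≤v) =
  suc k , p ∷ q , p≥1 ∷ q≥1 , refl , +-monoʳ-≤ (t p) m≤ , +-monoʳ-≤ (s p) ≤v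

add-ones : ∀ c {n m v} → Dominated n m v → Dominated (c + n) m v
add-ones zero    d = d
-- `t 1` and `s 1` both compute to 0, so a part 1 changes only the total size.
add-ones (suc c) d = add-part {1} ≤-refl (add-ones c d)

-- The lower bound

-- E stands for adjacency, H for the relation of forming a saturating pair.
module Saturation
  {V : Set} (_≟ⱽ_ : DecidableEquality V)
  {E H : Rel V 0ℓ} (E? : Decidable₂ E) (H? : Decidable₂ H)
  (E-sym : Symmetric E) (H-sym : Symmetric H)
  (H⇒¬E : ∀ {x y} → H x y → ¬ E x y)
  (path⇒H : ∀ {x y z} → x ≢ z → E x y → E y z → H x z)
  where

  open DecMembership _≟ⱽ_ using (_∈?_)

  e h : List V → ℕ
  e = pairs E?
  h = pairs H?

  -- Connected lists: crossing edges and components.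

  -- Connectedness; the vertex added last can be removed again.
  data Grown : List V → Set where
    [_]  : ∀ x → Grown (x ∷ [])
    grow : ∀ {x xs} → Grown xs → Any (E x) xs → Grown (x ∷ xs)

  -- The newest vertex `x` has an older neighbour `w`. If `P` separates them, `xw` is the crossing
  -- edge; otherwise `w` can stand in for `x` and the search continues among the older vertices.
  cut : ∀ {xs} → Grown xs → {P : Pred V 0ℓ} → Decidable P →
        ∀ {y z} → y ∈ xs → P y → z ∈ xs → ¬ P z →
        ∃[ u ] ∃[ v ] u ∈ xs × v ∈ xs × E u v × P u × ¬ P v
  cut [ x ] P? (here refl) py (here refl) ¬pz = contradiction py ¬pz
  cut (grow {x} g nb) P? y∈ py z∈ ¬pz with w , w∈ , xw ← find nb with P? x | P? w
  ... | yes px | no ¬pw = x , w , here refl , there w∈ , xw , px , ¬pw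
  ... | no ¬px | yes pw = w , x , there w∈ , here refl , E-sym xw , pw , ¬px
  ... | yes px | yes pw
    with u , v , u∈ , v∈ , rest ← cut g P? w∈ pw (tail (λ { refl → ¬pz px }) z∈) ¬pz =
    u , v , there u∈ , there v∈ , rest
  ... | no ¬px | no ¬pw
    with u , v , u∈ , v∈ , rest ← cut g P? (tail (λ { refl → ¬px py }) y∈) py w∈ ¬pw =
    u , v , there u∈ , there v∈ , rest

  extract : ∀ {x} {xs : List V} → x ∈ xs → ∃[ ys ] xs ↭ x ∷ ys
  extract {x} x∈ with as , bs , refl ← ∈-∃++ x∈ = as ++ bs , shift x as bs

  -- Starting from `x` alone, vertices of the remainder `R` with a neighbour in `T` are absorbed
  -- until there are none left. The number `n` bounds the length of `R` and ensures termination.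
  component : ∀ x ys → ∃[ T ] ∃[ R ] Grown T × x ∈ T × T ++ R ↭ x ∷ ys ×
              (∀ {u v} → u ∈ T → v ∈ R → ¬ E u v)
  component x ys = loop (length ys) (x ∷ []) ys ≤-refl [ x ] (here refl) ↭-refl
    where
    loop : ∀ n T R → length R ≤ n → Grown T → x ∈ T → T ++ R ↭ x ∷ ys →
           ∃[ T ] ∃[ R ] Grown T × x ∈ T × T ++ R ↭ x ∷ ys × (∀ {u v} → u ∈ T → v ∈ R → ¬ E u v)
    loop n T R R≤n g x∈T p with any? (λ y → any? (E? y) T) R
    ... | no none = T , R , g , x∈T , p , λ u∈ v∈ uv → none (lose v∈ (lose u∈ (E-sym uv)))
    ... | yes some with y , y∈R , nb ← find some with R′ , q ← extract y∈R with n
    ...   | zero  = contradiction (≤-trans (≤-reflexive (sym (↭-length q))) R≤n) λ ()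
    ...   | suc n = loop n (y ∷ T) R′ (s≤s⁻¹ (≤-trans (≤-reflexive (sym (↭-length q))) R≤n))
                      (grow g nb) (there x∈T)
                      (↭-trans (↭-sym (shift y T R′)) (↭-trans (++⁺ˡ T (↭-sym q)) p))

  -- The dichotomy and its behaviour when a vertex is added.

  TwoCliques : List V → Set
  TwoCliques S = ∃[ A ] ∃[ B ] S ↭ A ++ B × AllPairs H A × AllPairs H B

  -- The slack 1 is exactly what `part-suffices` can absorb. In the second alternative both sides
  -- are edgeless by `H⇒¬E`, so the list is bipartite.
  Dichotomy : List V → Set
  Dichotomy S = e S ≤ suc (h S) ⊎ TwoCliques S

  Dichotomy-↭ : ∀ {S S′} → S ↭ S′ → Dichotomy S → Dichotomy S′
  Dichotomy-↭ p (inj₁ le) = inj₁ (subst₂ (λ m n → m ≤ suc n) (pairs-↭ E? E-sym p) (pairs-↭ H? H-sym p) le)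
  Dichotomy-↭ p (inj₂ (A , B , q , hA , hB)) = inj₂ (A , B , ↭-trans (↭-sym p) q , hA , hB)

  e-clique : ∀ {A} → AllPairs H A → e A ≡ 0
  e-clique hA = pairs-none E? (AllPairs.map H⇒¬E hA)

  e-cliques : ∀ {A B} → AllPairs H A → AllPairs H B → e (A ++ B) ≡ cross E? A B
  e-cliques {A} {B} hA hB rewrite pairs-++ E? A B | e-clique hA | e-clique hB = +-identityʳ _

  h-cliques : ∀ A B → h A + h B ≤ h (A ++ B)
  h-cliques A B rewrite pairs-++ H? A B = m≤n+m _ (cross H? A B)

  N? : ∀ v → Decidable (λ w → ¬ E v w × ¬ H v w)
  N? v w = ¬? (E? v w) ×-dec ¬? (H? v w)

  trichotomy : ∀ v xs → length xs ≡ # (E? v) xs + # (H? v) xs + # (N? v) xs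
  trichotomy v []       = refl
  trichotomy v (x ∷ xs) with trichotomy v xs | E? v x | H? v x
  ... | ih | yes vx | yes hx = contradiction vx (H⇒¬E hx)
  ... | ih | yes _  | no _   = cong suc ih
  ... | ih | no _   | yes _  rewrite ih | +-suc (# (E? v) xs) (# (H? v) xs) = refl
  ... | ih | no _   | no _   rewrite ih = sym (+-suc _ _)

  #E≤#H : ∀ {v w} → E v w → ∀ B → v ∉ B → # (E? w) B ≤ # (H? v) B
  #E≤#H {v} {w} vw B v∉B = #-mono (E? w) (H? v) B λ y∈B wy → path⇒H (λ { refl → v∉B y∈B }) vw wy

  -- A common neighbour of `v` and `w` would give a path and hence `H v w`. So every neighbour of
  -- `w` is a non-neighbour of `v`.
  #E≤#H+#N : ∀ {v w} → v ≢ w → ¬ H v w → ∀ B → # (E? w) B ≤ # (H? v) B + # (N? v) B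
  #E≤#H+#N v≢w ¬h [] = z≤n
  #E≤#H+#N {v} {w} v≢w ¬h (y ∷ B) with #E≤#H+#N v≢w ¬h B | E? w y | E? v y | H? v y
  ... | ih | yes wy | yes vy | _     = contradiction (path⇒H v≢w vy (E-sym wy)) ¬h
  ... | ih | yes _  | no _   | yes _ = s≤s ih
  ... | ih | yes _  | no _   | no _  rewrite +-suc (# (H? v) B) (# (N? v) B) = s≤s ih
  ... | ih | no _   | yes _  | yes _ = m≤n⇒m≤1+n ih
  ... | ih | no _   | yes _  | no _  = ih
  ... | ih | no _   | no _   | yes _ = m≤n⇒m≤1+n ih
  ... | ih | no _   | no _   | no _  = ≤-trans ih (+-monoʳ-≤ _ (n≤1+n _))

  -- The vertices `w` of `A` are classified by their relation to `v`. If `w` is a neighbour of `v`,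
  -- its neighbours in `B` are `H`-partners of `v`; if `w` is an `H`-partner, the trivial bound is
  -- taken; otherwise `#E≤#H+#N` applies.
  cross-bound : ∀ v A B → v ∉ A → v ∉ B →
    cross E? A B ≤ # (E? v) A * # (H? v) B + # (H? v) A * length B
                 + # (N? v) A * (# (H? v) B + # (N? v) B)
  cross-bound v []      B v∉A v∉B = z≤n
  cross-bound v (w ∷ A) B v∉A v∉B
    with cross-bound v A B (v∉A ∘ there) v∉B | E? v w | H? v w
  ... | ih | yes vw | yes hw = contradiction vw (H⇒¬E hw)
  ... | ih | yes vw | no ¬h  =
    ≤-trans (+-mono-≤ (#E≤#H vw B v∉B) ih) (≤-reflexive (eq (# (H? v) B) (# (E? v) A * # (H? v) B) _ _))
    where
    eq : ∀ l x y z → l + (x + y + z) ≡ l + x + y + z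
    eq = solve-∀
  ... | ih | no _   | yes _  =
    ≤-trans (+-mono-≤ (length-filter (E? w) B) ih) (≤-reflexive (eq (length B) (# (E? v) A * # (H? v) B) _ _))
    where
    eq : ∀ l x y z → l + (x + y + z) ≡ x + (l + y) + z
    eq = solve-∀
  ... | ih | no _   | no ¬h  =
    ≤-trans (+-mono-≤ (#E≤#H+#N (v∉A ∘ here) ¬h B) ih)
            (≤-reflexive (eq (# (H? v) B + # (N? v) B) (# (E? v) A * # (H? v) B) (# (H? v) A * length B) _))
    where
    eq : ∀ l x y z → l + (x + y + z) ≡ x + y + (l + z)
    eq = solve-∀

  module Extension (v : V) {A B : List V} (v∉A : v ∉ A) (v∉B : v ∉ B)
                   (hA : AllPairs H A) (hB : AllPairs H B) where

    conclude : # (E? v) A + # (E? v) B + cross E? A B ≤ suc (# (H? v) A + # (H? v) B) + (h A + h B) →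
               e (v ∷ A ++ B) ≤ suc (h (v ∷ A ++ B))
    conclude le = begin
      # (E? v) (A ++ B) + e (A ++ B)                         ≡⟨ cong₂ _+_ (#-++ (E? v) A B) (e-cliques hA hB) ⟩
      # (E? v) A + # (E? v) B + cross E? A B                 ≤⟨ le ⟩
      suc (# (H? v) A + # (H? v) B) + (h A + h B)            ≤⟨ +-mono-≤ (≤-reflexive (cong suc (sym (#-++ (H? v) A B)))) (h-cliques A B) ⟩
      suc (# (H? v) (A ++ B) + h (A ++ B))                   ∎
      where open ≤-Reasoning

    -- The size of `C` is expressed through the three degrees of `v` into `C`, the form that
    -- `one-sided` and `two-sided` expect.
    h-clique : ∀ {C} → AllPairs H C → let c = # (E? v) C + # (H? v) C + # (N? v) C in c + 2 * h C ≡ c * c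
    h-clique {C} hC = subst (λ n → n + 2 * h C ≡ n * n) (trichotomy v C) (pairs-all H? hC)

    bound : cross E? A B ≤ # (E? v) A * # (H? v) B
                         + # (H? v) A * (# (E? v) B + # (H? v) B + # (N? v) B)
                         + # (N? v) A * (# (H? v) B + # (N? v) B)
    bound = subst (λ n → cross E? A B ≤ # (E? v) A * # (H? v) B + # (H? v) A * n + # (N? v) A * (# (H? v) B + # (N? v) B))
                  (trichotomy v B) (cross-bound v A B v∉A v∉B)

    -- If `v` is an `H`-partner of all of `B`, it joins that clique. Otherwise some vertex of `B` is
    -- neither a neighbour nor an `H`-partner, which supplies `r ≥ 1` for `one-sided`.
    extend-one-sided : 1 ≤ # (E? v) A → # (E? v) B ≡ 0 → Dichotomy (v ∷ A ++ B)
    extend-one-sided i≥1 j≡0 with all? (H? v) B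
    ... | yes Hv  = inj₂ (A , v ∷ B , ↭-sym (shift v A B) , hA , Hv ∷ hB)
    ... | no ¬Hv = inj₁ (conclude goal)
      where
      r≥1 : 1 ≤ # (N? v) B
      r≥1 = +-cancelˡ-≤ (# (H? v) B) _ _ (begin
        # (H? v) B + 1                               ≡⟨ +-comm _ 1 ⟩
        suc (# (H? v) B)                             ≤⟨ filter-notAll (H? v) B (¬All⇒Any¬ (H? v) B ¬Hv) ⟩
        length B                                     ≡⟨ trichotomy v B ⟩
        # (E? v) B + # (H? v) B + # (N? v) B         ≡⟨ cong (λ j → j + # (H? v) B + # (N? v) B) j≡0 ⟩
        # (H? v) B + # (N? v) B                      ∎)
        where open ≤-Reasoning
      i = # (E? v) A
      κ = # (H? v) A
      p = # (N? v) A
      l = # (H? v) B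
      r = # (N? v) B
      c = cross E? A B
      -- The degree of `v` into `B` is generalised to a variable `j`, so that matching on `j ≡ 0`
      -- removes it from the size of `B` and from the bound on `c`.
      with-j : ∀ j → j ≡ 0 → (j + l + r) + 2 * h B ≡ (j + l + r) * (j + l + r) →
               c ≤ i * l + κ * (j + l + r) + p * (l + r) → i + j + c ≤ suc (κ + l) + (h A + h B)
      with-j _ refl β≡ c≤ rewrite +-identityʳ i =
        one-sided i κ p l r (h A) (h B) i≥1 r≥1 (h-clique hA) β≡ c≤
      goal : i + # (E? v) B + c ≤ suc (κ + l) + (h A + h B)
      goal = with-j (# (E? v) B) j≡0 (h-clique hB) bound

    extend-two-sided : 1 ≤ # (E? v) A → 1 ≤ # (E? v) B →
      # (E? v) A + # (E? v) B ≤ # (H? v) A + # (H? v) B → Dichotomy (v ∷ A ++ B)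
    extend-two-sided i≥1 j≥1 d≤k = inj₁ (conclude
      (two-sided (# (E? v) A) (# (H? v) A) (# (N? v) A) (# (E? v) B) (# (H? v) B) (# (N? v) B) (h A) (h B)
         i≥1 j≥1 d≤k (h-clique hA) (h-clique hB) bound))

  ≡0⊎≥1 : ∀ n → n ≡ 0 ⊎ 1 ≤ n
  ≡0⊎≥1 zero    = inj₁ refl
  ≡0⊎≥1 (suc n) = inj₂ (s≤s z≤n)

  -- The degree hypothesis carries the first alternative over and feeds the case of neighbours on
  -- both sides. The neighbour in `T` excludes that `v` misses both sides.
  Dichotomy-∷ : ∀ {v T} → v ∉ T → Any (E v) T → # (E? v) T ≤ # (H? v) T → Dichotomy T → Dichotomy (v ∷ T)
  Dichotomy-∷ {v} {T} v∉T nb d≤k (inj₁ le) = inj₁ (begin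
    # (E? v) T + e T        ≤⟨ +-mono-≤ d≤k le ⟩
    # (H? v) T + suc (h T)  ≡⟨ +-suc _ _ ⟩
    suc (# (H? v) T + h T)  ∎)
    where open ≤-Reasoning
  Dichotomy-∷ {v} {T} v∉T nb d≤k (inj₂ (A , B , T↭ , hA , hB)) =
    Dichotomy-↭ (prep v (↭-sym T↭)) (by-sides (≡0⊎≥1 (# (E? v) A)) (≡0⊎≥1 (# (E? v) B)))
    where
    v∉AB : v ∉ A ++ B
    v∉AB = v∉T ∘ ∈-resp-↭ (↭-sym T↭)
    v∉A : v ∉ A
    v∉A = v∉AB ∘ ∈-++⁺ˡ
    v∉B : v ∉ B
    v∉B = v∉AB ∘ ∈-++⁺ʳ A
    some-nb : 1 ≤ # (E? v) A + # (E? v) B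
    some-nb = subst (1 ≤_) (#-++ (E? v) A B) (filter-some (E? v) (Any-resp-↭ T↭ nb))
    d≤k′ : # (E? v) A + # (E? v) B ≤ # (H? v) A + # (H? v) B
    d≤k′ = begin
      # (E? v) A + # (E? v) B  ≡⟨ #-++ (E? v) A B ⟨
      # (E? v) (A ++ B)        ≡⟨ #-↭ (E? v) T↭ ⟨
      # (E? v) T               ≤⟨ d≤k ⟩
      # (H? v) T               ≡⟨ #-↭ (H? v) T↭ ⟩
      # (H? v) (A ++ B)        ≡⟨ #-++ (H? v) A B ⟩
      # (H? v) A + # (H? v) B  ∎
      where open ≤-Reasoning
    by-sides : # (E? v) A ≡ 0 ⊎ 1 ≤ # (E? v) A → # (E? v) B ≡ 0 ⊎ 1 ≤ # (E? v) B → Dichotomy (v ∷ A ++ B)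
    by-sides (inj₂ i≥1) (inj₂ j≥1) = Extension.extend-two-sided v v∉A v∉B hA hB i≥1 j≥1 d≤k′
    by-sides (inj₂ i≥1) (inj₁ j≡0) = Extension.extend-one-sided v v∉A v∉B hA hB i≥1 j≡0
    by-sides (inj₁ i≡0) (inj₂ j≥1) =
      Dichotomy-↭ (prep v (++-comm B A)) (Extension.extend-one-sided v v∉B v∉A hB hA j≥1 i≡0)
    by-sides (inj₁ i≡0) (inj₁ j≡0) =
      contradiction (subst₂ (λ m n → 1 ≤ m + n) i≡0 j≡0 some-nb) λ ()

  -- Edges whose ends both have more neighbours than `H`-partners.

  neighbours-clique : ∀ {x xs} → Unique xs → All (E x) xs → AllPairs H xs
  neighbours-clique []       []        = []
  neighbours-clique (x∉ ∷ u) (xy ∷ xs) =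
    All.zipWith (λ (y≢z , xz) → path⇒H y≢z (E-sym xy) xz) (x∉ , xs) ∷ neighbours-clique u xs

  filter-complement-↭ : {P : Pred V 0ℓ} (P? : Decidable P) → ∀ xs →
                        xs ↭ filter P? xs ++ filter (¬? ∘ P?) xs
  filter-complement-↭ P? []       = ↭-refl
  filter-complement-↭ P? (x ∷ xs) with P? x
  ... | yes _ = prep x (filter-complement-↭ P? xs)
  ... | no  _ = ↭-trans (prep x (filter-complement-↭ P? xs)) (↭-sym (shift x (filter P? xs) _))

  -- All four degrees in the hypotheses are then forced to agree, so that the E-neighbours of x
  -- are the H-neighbours of w and conversely.
  saturated⇒TwoCliques : ∀ {S x w zs} → Grown S → S ↭ x ∷ w ∷ zs → Unique (x ∷ w ∷ zs) → E x w →
                  # (H? x) (w ∷ zs) < # (E? x) (w ∷ zs) → # (H? w) (x ∷ zs) < # (E? w) (x ∷ zs) → TwoCliques S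
  saturated⇒TwoCliques {S} {x} {w} {zs} g S↭ (x∉@(_ ∷ x∉zs) ∷ w∉ ∷ u) xw kx<dx kw<dw =
    -- The first side consists of neighbours of `x`, the second of neighbours of `w`; the latter
    -- rests on `covered`.
    w ∷ filter (E? x) zs , x ∷ filter (¬? ∘ E? x) zs ,
    ↭-trans S↭ (↭-trans (swap x w (filter-complement-↭ (E? x) zs)) (prep w (↭-sym (shift x _ _)))) ,
    neighbours-clique (All.tabulate (λ y∈ → All.lookup w∉ (proj₁ (∈-filter⁻ (E? x) y∈))) ∷ filter⁺ (E? x) u)
      (xw ∷ all-filter (E? x) zs) ,
    neighbours-clique (All.tabulate (λ y∈ → All.lookup x∉zs (proj₁ (∈-filter⁻ (¬? ∘ E? x) y∈))) ∷ filter⁺ (¬? ∘ E? x) u)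
      (E-sym xw ∷ All.tabulate (λ y∈ → let y∈zs , ¬xy = ∈-filter⁻ (¬? ∘ E? x) y∈ in covered y∈zs ¬xy))
    where
    open ≤-Reasoning
    Ew⇒Hx : ∀ {y} → y ∈ zs → E w y → H x y
    Ew⇒Hx y∈ wy = path⇒H (All.lookup x∉zs y∈) xw wy
    Ex⇒Hw : ∀ {y} → y ∈ zs → E x y → H w y
    Ex⇒Hw y∈ xy = path⇒H (All.lookup w∉ y∈) (E-sym xw) xy
    -- The edge `xw` counts once for `E` and not for `H`, so discarding it turns the strict
    -- inequality into a weak one on `zs`.
    Hx≤Ex : # (H? x) zs ≤ # (E? x) zs
    Hx≤Ex = s≤s⁻¹ (subst₂ _<_ (#-no (H? x) zs (λ hxw → H⇒¬E hxw xw)) (#-yes (E? x) zs xw) kx<dx)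
    Hw≤Ew : # (H? w) zs ≤ # (E? w) zs
    Hw≤Ew = s≤s⁻¹ (subst₂ _<_ (#-no (H? w) zs (λ hwx → H⇒¬E hwx (E-sym xw))) (#-yes (E? w) zs (E-sym xw)) kw<dw)
    -- The counts form a closed chain: `H w ≤ E w ≤ H x ≤ E x ≤ H w`. Hence the inclusions `Ew⇒Hx`
    -- and `Ex⇒Hw` can be reversed.
    Hw≤Ex : # (H? w) zs ≤ # (E? x) zs
    Hw≤Ex = ≤-trans Hw≤Ew (≤-trans (#-mono (E? w) (H? x) zs Ew⇒Hx) Hx≤Ex)
    Hx≤Ew : # (H? x) zs ≤ # (E? w) zs
    Hx≤Ew = ≤-trans Hx≤Ex (≤-trans (#-mono (E? x) (H? w) zs Ex⇒Hw) Hw≤Ew)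
    Hw⇒Ex : ∀ {y} → y ∈ zs → H w y → E x y
    Hw⇒Ex = #-mono⁻ (E? x) (H? w) zs Ex⇒Hw Hw≤Ex
    Hx⇒Ew : ∀ {y} → y ∈ zs → H x y → E w y
    Hx⇒Ew = #-mono⁻ (E? w) (H? x) zs Ew⇒Hx Hx≤Ew
    in-zs : ∀ {v} → v ∈ S → ¬ (E x v ⊎ E w v) → v ∈ zs
    in-zs v∈S ¬p with ∈-resp-↭ S↭ v∈S
    ... | here refl         = contradiction (inj₂ (E-sym xw)) ¬p
    ... | there (here refl) = contradiction (inj₁ xw) ¬p
    ... | there (there v∈)  = v∈
    covered : ∀ {y} → y ∈ zs → ¬ E x y → E w y
    covered {y} y∈zs ¬xy = decidable-stable (E? w y) λ ¬wy →
      -- If `y` were adjacent to neither `x` nor `w`, an edge `uv` would leave the union of the two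
      -- neighbourhoods. Then `v` is an `H`-partner of the one of `x`, `w` that is adjacent to `u`,
      -- hence a neighbour of the other, and lies in the union after all.
      let u , v , _ , v∈S , uv , pu , ¬pv =
            cut g (λ y → E? x y ⊎-dec E? w y) (∈-resp-↭ (↭-sym S↭) (here refl)) (inj₂ (E-sym xw))
                (∈-resp-↭ (↭-sym S↭) (there (there y∈zs))) [ ¬xy , ¬wy ]′
          v∈zs = in-zs v∈S ¬pv
      in [ (λ xu → ¬pv (inj₂ (Hx⇒Ew v∈zs (path⇒H (All.lookup x∉zs v∈zs) xu uv))))
         , (λ wu → ¬pv (inj₁ (Hw⇒Ex v∈zs (path⇒H (All.lookup w∉ v∈zs) wu uv)))) ]′ pu

  Unique-++-disjoint : ∀ {xs ys} {x : V} → Unique (xs ++ ys) → x ∈ xs → x ∉ ys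
  Unique-++-disjoint {_ ∷ xs} (x∉ ∷ u) (here refl)  x∈ys = All.lookup x∉ (∈-++⁺ʳ xs x∈ys) refl
  Unique-++-disjoint          (x∉ ∷ u) (there x∈xs) x∈ys = Unique-++-disjoint u x∈xs x∈ys

  Unique-++⁻ : ∀ xs {ys : List V} → Unique (xs ++ ys) → Unique xs × Unique ys
  Unique-++⁻ []       u        = [] , u
  Unique-++⁻ (x ∷ xs) (x∉ ∷ u) with uxs , uys ← Unique-++⁻ xs u = ++⁻ˡ xs x∉ ∷ uxs , uys

  Unique-↭ : ∀ {xs ys : List V} → xs ↭ ys → Unique xs → Unique ys
  Unique-↭ p = Unique-resp-↭ (setoid V) (↭⇒↭ₛ p)

  -- Removing a neighbour of the newest vertex while staying connected.

  module Step {x S} (g : Grown (x ∷ S)) (uniq : Unique (x ∷ S)) where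

    -- The obstruction to deleting the neighbour w of x without disconnecting the list.
    Private : V → V → Set
    Private w u = E w u × All (λ w′ → E x w′ → E w′ u → w′ ≡ w) S

    Private? : Decidable₂ Private
    Private? w u = E? w u ×-dec all? (λ w′ → E? x w′ →-dec (E? w′ u →-dec (w′ ≟ⱽ w))) S

    -- If every neighbour `w` of `x` had a private vertex `u`, then `u` would be an `H`-partner of
    -- `x` through `w`, and different `w` would have different `u`. This would give at least as many
    -- `H`-partners as neighbours.
    removable : # (H? x) S < # (E? x) S → ∃[ w ] w ∈ S × E x w × ¬ Any (Private w) S
    removable k<d with any? (λ w → E? x w ×-dec ¬? (any? (Private? w) S)) S
    ... | yes some = find some
    ... | no none = contradiction
      (pigeonhole (λ w u → w ∈ S × E x w × Private w u)
        (λ (w∈ , xw , wu , _) (_ , _ , _ , all) → All.lookup all w∈ xw wu)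
        (filter⁺ (E? x) (AllPairs.tail uniq)) (filter (H? x) S) witness)
      (<⇒≱ k<d)
      where
      witness : ∀ {w} → w ∈ filter (E? x) S → ∃[ u ] u ∈ filter (H? x) S × w ∈ S × E x w × Private w u
      witness {w} w∈f =
        let w∈ , xw = ∈-filter⁻ (E? x) w∈f
            u , u∈ , pr = find (decidable-stable (any? (Private? w) S) λ ¬pr → none (lose w∈ (xw , ¬pr)))
        in u , ∈-filter⁺ (H? x) u∈ (path⇒H (All.lookup (AllPairs.head uniq) u∈) xw (proj₁ pr)) , w∈ , xw , pr

    -- If the component `T` of `x` after removing `w` left a nonempty remainder `R`, connectedness
    -- of `x ∷ S` would give an edge from `R` to outside `R`. It can only end in `w`, and its end in
    -- `R` would be private to `w`.
    still-grown : ∀ {w zs} → S ↭ w ∷ zs → E x w → ¬ Any (Private w) S →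
                  ∃[ T ] Grown T × T ↭ x ∷ zs
    still-grown {w} {zs} S↭ xw ¬private with component x zs
    ... | T , [] , gT , x∈T , p , _ = T , gT , subst (_↭ x ∷ zs) (++-identityʳ T) p
    ... | T , R@(r ∷ _) , gT , x∈T , p , sep = contradiction (here refl) (R-empty {r})
      where
      T∩R : ∀ {y} → y ∈ T → y ∉ R
      T∩R = Unique-++-disjoint (Unique-↭ (↭-sym p) (dropped (Unique-↭ (prep x S↭) uniq)))
        where
        dropped : Unique (x ∷ w ∷ zs) → Unique (x ∷ zs)
        dropped ((_ ∷ x∉) ∷ _ ∷ u) = x∉ ∷ u
      R⊆S : ∀ {y} → y ∈ R → y ∈ x ∷ S
      R⊆S y∈R = ∈-resp-↭ (prep x (↭-sym S↭)) (weaken (∈-resp-↭ p (∈-++⁺ʳ T y∈R)))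
        where
        weaken : ∀ {y} → y ∈ x ∷ zs → y ∈ x ∷ w ∷ zs
        weaken (here eq)  = here eq
        weaken (there y∈) = there (there y∈)
      side : ∀ {v} → v ∈ x ∷ S → v ≡ w ⊎ v ∈ T ⊎ v ∈ R
      side v∈ with ∈-resp-↭ (prep x S↭) v∈
      ... | here refl         = inj₂ (inj₁ x∈T)
      ... | there (here refl) = inj₁ refl
      ... | there (there v∈′) = inj₂ (∈-++⁻ T (∈-resp-↭ (↭-sym p) (there v∈′)))
      R-empty : ∀ {r} → r ∉ R
      R-empty r∈R
        with u , v , u∈S , v∈S , uv , u∈R , v∉R ←
               cut g (_∈? R) (R⊆S r∈R) r∈R (here refl) (T∩R x∈T)
        with side v∈S
      ... | inj₂ (inj₁ v∈T) = sep v∈T u∈R (E-sym uv)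
      ... | inj₂ (inj₂ v∈R) = v∉R v∈R
      -- Another neighbour of `x` adjacent to `u` would lie in `T` or in `R`. Either way `sep` is
      -- violated, by its edge to `u` or by its edge to `x`.
      ... | inj₁ refl = ¬private (lose (tail (λ { refl → T∩R x∈T u∈R }) u∈S)
          (E-sym uv , All.tabulate λ w′∈ xw′ w′u → only-w (side (there w′∈)) xw′ w′u))
        where
        only-w : ∀ {w′} → w′ ≡ w ⊎ w′ ∈ T ⊎ w′ ∈ R → E x w′ → E w′ u → w′ ≡ w
        only-w (inj₁ eq)         _   _   = eq
        only-w (inj₂ (inj₁ w′∈T)) _   w′u = contradiction w′u (sep w′∈T u∈R)
        only-w (inj₂ (inj₂ w′∈R)) xw′ _   = contradiction xw′ (sep x∈T w′∈R)

  -- The vertex removed is `x`, or else the removable neighbour `w` of `x`; if both have more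
  -- neighbours than `H`-partners, `saturated⇒TwoCliques` applies. Induction is on a length bound
  -- because removing `w` leaves a regrown permutation `T` and not a sublist.
  grown⇒Dichotomy : ∀ n {S} → length S ≤ n → Grown S → Unique S → Dichotomy S
  grown⇒Dichotomy n       len [ x ] uniq = inj₁ z≤n
  grown⇒Dichotomy (suc n) (s≤s len) (grow {x} {S} g nb) uniq with # (E? x) S ≤? # (H? x) S
  ... | yes d≤k = Dichotomy-∷ (Unique[x∷xs]⇒x∉xs uniq) nb d≤k (grown⇒Dichotomy n len g (AllPairs.tail uniq))
  ... | no  d≰k
    with w , w∈S , xw , ¬private ← Step.removable (grow g nb) uniq (≰⇒> d≰k)
    with zs , S↭ ← extract w∈S
    with T , gT , T↭ ← Step.still-grown (grow g nb) uniq S↭ xw ¬private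
    = by-degree uniq′ (# (E? w) (x ∷ zs) ≤? # (H? w) (x ∷ zs))
    where
    uniq′ : Unique (x ∷ w ∷ zs)
    uniq′ = Unique-↭ (prep x S↭) uniq
    by-degree : Unique (x ∷ w ∷ zs) → Dec (# (E? w) (x ∷ zs) ≤ # (H? w) (x ∷ zs)) → Dichotomy (x ∷ S)
    by-degree _ (no d≰k′) = inj₂ (saturated⇒TwoCliques (grow g nb) (prep x S↭) uniq′ xw
      (subst₂ _<_ (#-↭ (H? x) S↭) (#-↭ (E? x) S↭) (≰⇒> d≰k)) (≰⇒> d≰k′))
    by-degree ((x≢w ∷ x∉) ∷ w∉ ∷ u) (yes d≤k) =
      Dichotomy-↭ (↭-trans (prep w T↭) (↭-trans (swap w x ↭-refl) (prep x (↭-sym S↭))))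
        (Dichotomy-∷ w∉T (lose (∈-resp-↭ (↭-sym T↭) (here refl)) (E-sym xw))
          (subst₂ _≤_ (sym (#-↭ (E? w) T↭)) (sym (#-↭ (H? w) T↭)) d≤k)
          (grown⇒Dichotomy n (≤-trans (≤-reflexive T≡S) len) gT (Unique-↭ (↭-sym T↭) (x∉ ∷ u))))
      where
      w∉T : w ∉ T
      w∉T w∈T with ∈-resp-↭ T↭ w∈T
      ... | here refl  = x≢w refl
      ... | there w∈zs = All.lookup w∉ w∈zs refl
      T≡S : length T ≡ length S
      T≡S = trans (↭-length T↭) (sym (↭-length S↭))

  -- From the dichotomy to a partition.

  part-suffices : ∀ n {m v} → m ≤ suc v → m ≤ t (suc n) →
                  ∃[ q ] q ≤ n × m ≤ t (suc q) × s (suc q) ≤ v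
  part-suffices zero    m≤1+v m≤t = 0 , z≤n , m≤t , z≤n
  part-suffices (suc n) {m} m≤1+v m≤t with m ≤? t (suc n)
  ... | yes m≤t′ with q , q≤n , rest ← part-suffices n m≤1+v m≤t′ = q , m≤n⇒m≤1+n q≤n , rest
  -- The descent has reached the least part that is large enough. Its cost `s (suc (suc n))` is
  -- `t (suc n)` by definition, and `t (suc n) < m ≤ suc v`.
  ... | no  m≰t′ = suc n , ≤-refl , m≤t , s≤s⁻¹ (≤-trans (≰⇒> m≰t′) m≤1+v)

  2[e+h]+n≤n² : ∀ xs → 2 * (e xs + h xs) + length xs ≤ length xs * length xs
  2[e+h]+n≤n² []       = z≤n
  2[e+h]+n≤n² (x ∷ xs) = begin
    2 * (dE + e xs + (dH + h xs)) + suc n          ≡⟨ eq₁ dE (e xs) dH (h xs) n ⟩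
    suc (n + 2 * (dE + dH) + (2 * (e xs + h xs)))  ≤⟨ s≤s (+-monoˡ-≤ _ (+-monoʳ-≤ n (*-monoʳ-≤ 2 dE+dH≤n))) ⟩
    suc (n + 2 * n + 2 * (e xs + h xs))            ≡⟨ eq₂ n (2 * (e xs + h xs)) ⟩
    suc (2 * n + (2 * (e xs + h xs) + n))          ≤⟨ s≤s (+-monoʳ-≤ (2 * n) (2[e+h]+n≤n² xs)) ⟩
    suc (2 * n + n * n)                            ≡⟨ eq₃ n ⟩
    suc n * suc n                                  ∎
    where
    open ≤-Reasoning
    n  = length xs
    dE = # (E? x) xs
    dH = # (H? x) xs
    dE+dH≤n : dE + dH ≤ n
    dE+dH≤n = ≤-trans (m≤m+n (dE + dH) (# (N? x) xs)) (≤-reflexive (sym (trichotomy x xs)))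
    eq₁ : ∀ a b c d n → 2 * (a + b + (c + d)) + suc n ≡ suc (n + 2 * (a + c) + 2 * (b + d))
    eq₁ = solve-∀
    eq₂ : ∀ n y → suc (n + 2 * n + y) ≡ suc (2 * n + (y + n))
    eq₂ = solve-∀
    eq₃ : ∀ n → suc (2 * n + n * n) ≡ suc n * suc n
    eq₃ = solve-∀

  -- For `n = length xs ≥ 2`, `4e ≤ 2(e + h) + 2 ≤ n² - n + 2 ≤ n²`. The last inequality fails for
  -- `n = 1`, so short lists are treated separately.
  e≤1+h⇒e≤t : ∀ xs → e xs ≤ suc (h xs) → e xs ≤ t (length xs)
  e≤1+h⇒e≤t []           _  = z≤n
  e≤1+h⇒e≤t (x ∷ [])     _  = z≤n
  e≤1+h⇒e≤t xs@(_ ∷ ys@(_ ∷ _)) le = ≤t n (+-cancelʳ-≤ n _ _ (begin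
    m * 4 + n                  ≡⟨ eq₁ m n ⟩
    2 * (m + m) + n            ≤⟨ +-monoˡ-≤ n (*-monoʳ-≤ 2 (+-monoʳ-≤ m le)) ⟩
    2 * (m + suc (h xs)) + n   ≡⟨ eq₂ m (h xs) n ⟩
    2 * (m + h xs) + n + 2     ≤⟨ +-mono-≤ (2[e+h]+n≤n² xs) (s≤s (s≤s z≤n)) ⟩
    n * n + n                  ∎))
    where
    open ≤-Reasoning
    m = e xs
    n = length xs
    eq₁ : ∀ m n → m * 4 + n ≡ 2 * (m + m) + n
    eq₁ = solve-∀
    eq₂ : ∀ m v n → 2 * (m + suc v) + n ≡ 2 * (m + v) + n + 2
    eq₂ = solve-∀

  grown⇒part : ∀ {S} → Grown S → Unique S →
               ∃[ q ] 1 ≤ q × q ≤ length S × e S ≤ t q × s q ≤ h S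
  grown⇒part {x ∷ S} g uniq with grown⇒Dichotomy _ ≤-refl g uniq
  ... | inj₁ le with q , q≤ , rest ← part-suffices (length S) le (e≤1+h⇒e≤t (x ∷ S) le) =
    suc q , s≤s z≤n , s≤s q≤ , rest
  ... | inj₂ (A , B , p , hA , hB) =
    length (x ∷ S) , s≤s z≤n , ≤-refl , e≤t , s≤h
    where
    open ≤-Reasoning
    |S| : length A + length B ≡ length (x ∷ S)
    |S| = sym (trans (↭-length p) (length-++ A))
    e≤t : e (x ∷ S) ≤ t (length (x ∷ S))
    e≤t = begin
      e (x ∷ S)               ≡⟨ trans (pairs-↭ E? E-sym p) (e-cliques hA hB) ⟩
      cross E? A B            ≤⟨ cross-≤ E? A B ⟩
      length A * length B     ≤⟨ ab≤t[a+b] (length A) (length B) ⟩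
      t (length A + length B) ≡⟨ cong t |S| ⟩
      t (length (x ∷ S))      ∎
    s≤h : s (length (x ∷ S)) ≤ h (x ∷ S)
    s≤h = begin
      s (length (x ∷ S))      ≡⟨ cong s |S| ⟨
      s (length A + length B) ≤⟨ s[a+b]≤ (length A) (length B) (h A) (h B) (pairs-all H? hA) (pairs-all H? hB) ⟩
      h A + h B               ≤⟨ h-cliques A B ⟩
      h (A ++ B)              ≡⟨ pairs-↭ H? H-sym p ⟨
      h (x ∷ S)               ∎

  -- One component is split off at a time. Its part `q` may be smaller than the component, and the
  -- difference is filled with parts 1; `n` is a length bound for the recursion.
  dominated : ∀ n xs → length xs ≤ n → Unique xs → Dominated (length xs) (e xs) (h xs)
  dominated n       []       len       uniq = 0 , [] , [] , refl , z≤n , z≤n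
  dominated (suc n) (x ∷ ys) (s≤s len) uniq
    with T , R , gT , x∈T , p , sep ← component x ys
    with uniqT , uniqR ← Unique-++⁻ T (Unique-↭ (↭-sym p) uniq)
    with q , q≥1 , q≤T , eT≤t , s≤hT ← grown⇒part gT uniqT
    = Dominated-resp size edges saturating
        (add-part q≥1 (add-ones (length T ∸ q) (dominated n R R≤n uniqR)))
    where
    open ≤-Reasoning
    |T|+|R| : length T + length R ≡ suc (length ys)
    |T|+|R| = trans (sym (length-++ T)) (↭-length p)
    1≤T : 1 ≤ length T
    1≤T = ≤-trans q≥1 q≤T
    R≤n : length R ≤ n
    R≤n = s≤s⁻¹ (begin
      1 + length R         ≤⟨ +-monoˡ-≤ (length R) 1≤T ⟩
      length T + length R  ≡⟨ |T|+|R| ⟩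
      suc (length ys)      ≤⟨ s≤s len ⟩
      suc n                ∎)
    size : q + (length T ∸ q + length R) ≡ suc (length ys)
    size = begin-equality
      q + (length T ∸ q + length R)  ≡⟨ +-assoc q _ _ ⟨
      q + (length T ∸ q) + length R  ≡⟨ cong (_+ length R) (m+[n∸m]≡n q≤T) ⟩
      length T + length R            ≡⟨ |T|+|R| ⟩
      suc (length ys)                ∎
    edges : e (x ∷ ys) ≤ t q + e R
    edges = begin
      e (x ∷ ys)                     ≡⟨ pairs-↭ E? E-sym p ⟨
      e (T ++ R)                     ≡⟨ pairs-++ E? T R ⟩
      cross E? T R + (e T + e R)     ≡⟨ cong (_+ (e T + e R)) (cross-none E? T sep) ⟩
      e T + e R                      ≤⟨ +-monoˡ-≤ (e R) eT≤t ⟩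
      t q + e R                      ∎
    saturating : s q + h R ≤ h (x ∷ ys)
    saturating = begin
      s q + h R                      ≤⟨ +-monoˡ-≤ (h R) s≤hT ⟩
      h T + h R                      ≤⟨ h-cliques T R ⟩
      h (T ++ R)                     ≡⟨ pairs-↭ H? H-sym p ⟩
      h (x ∷ ys)                     ∎

-- Counts over `vertexPairs` as counts of pairs in a list.

module _ {n : ℕ} {R : Rel (Fin n) 0ℓ} (R? : Decidable₂ R) where

  ordered : Decidable λ ((x , y) : Fin n × Fin n) → x <ᶠ y × R x y
  ordered (x , y) = x <? y ×-dec R? x y

  -- Every `z` in `xs` lies above `x`, so the pairs `(z , x)` fail the order condition and a column
  -- of the square contributes nothing.
  #-column : ∀ x xs ys → All (x <ᶠ_) xs →
             # ordered (cartesianProduct xs (x ∷ ys)) ≡ # ordered (cartesianProduct xs ys)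
  #-column x []       ys []           = refl
  #-column x (z ∷ zs) ys (x<z ∷ x<zs) = begin
    # ordered ((z , x) ∷ map (z ,_) ys ++ cartesianProduct zs (x ∷ ys))
      ≡⟨ #-no ordered _ (λ (z<x , _) → Fin.<-asym z<x x<z) ⟩
    # ordered (map (z ,_) ys ++ cartesianProduct zs (x ∷ ys))
      ≡⟨ #-++ ordered (map (z ,_) ys) _ ⟩
    # ordered (map (z ,_) ys) + # ordered (cartesianProduct zs (x ∷ ys))
      ≡⟨ cong (# ordered (map (z ,_) ys) +_) (#-column x zs ys x<zs) ⟩
    # ordered (map (z ,_) ys) + # ordered (cartesianProduct zs ys)
      ≡⟨ #-++ ordered (map (z ,_) ys) _ ⟨
    # ordered (map (z ,_) ys ++ cartesianProduct zs ys) ∎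
    where open ≡-Reasoning

  #-square : ∀ {xs} → AllPairs _<ᶠ_ xs → # ordered (cartesianProduct xs xs) ≡ pairs R? xs
  #-square []                         = refl
  #-square {x ∷ xs} (x<xs ∷ sorted) = begin
    # ordered ((x , x) ∷ map (x ,_) xs ++ cartesianProduct xs (x ∷ xs))
      ≡⟨ #-no ordered (map (x ,_) xs ++ cartesianProduct xs (x ∷ xs)) (λ (x<x , _) → Fin.<-irrefl {x = x} refl x<x) ⟩
    # ordered (map (x ,_) xs ++ cartesianProduct xs (x ∷ xs))
      ≡⟨ #-++ ordered (map (x ,_) xs) _ ⟩
    # ordered (map (x ,_) xs) + # ordered (cartesianProduct xs (x ∷ xs))
      ≡⟨ cong₂ _+_ (trans (#-map ordered (x ,_) xs) row) (trans (#-column x xs xs x<xs) (#-square sorted)) ⟩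
    # (R? x) xs + pairs R? xs ∎
    where
    open ≡-Reasoning
    row : # (ordered ∘ (x ,_)) xs ≡ # (R? x) xs
    row = #-cong (ordered ∘ (x ,_)) (R? x) xs (λ _ → proj₂) (λ y∈ r → All.lookup x<xs y∈ , r)

  #-vertexPairs : # (uncurry R?) (vertexPairs n) ≡ pairs R? (allFin n)
  #-vertexPairs = trans (#-filter (uncurry R?) (uncurry _<?_) (cartesianProduct (allFin n) (allFin n)))
                        (#-square (tabulate⁺-< id))

triangleSaturating-sym : ∀ {n} (G : Graph n) → Symmetric (TriangleSaturating G)
triangleSaturating-sym G (x≢y , ¬xy , u , v , w , uv , vw , uw) =
  x≢y ∘ sym , ¬xy ∘ adj-sym G , u , v , w , flip uv , flip vw , flip uw
  where
  flip : ∀ {u v} → Adj (addEdge G x≢y) u v → Adj (addEdge G (x≢y ∘ sym)) u v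
  flip (inj₁ uv)        = inj₁ uv
  flip (inj₂ (inj₁ eq)) = inj₂ (inj₂ eq)
  flip (inj₂ (inj₂ eq)) = inj₂ (inj₁ eq)

path⇒saturating : ∀ {n} (G : Graph n) → TriangleFree G → ∀ {x y z} →
  x ≢ z → Adj G x y → Adj G y z → TriangleSaturating G x z
path⇒saturating G free {x} {y} {z} x≢z xy yz =
  x≢z , (λ xz → free (x , y , z , xy , yz , xz)) ,
  x , y , z , inj₁ xy , inj₁ yz , inj₂ (inj₁ (refl , refl))

graph⇒partition : ∀ {n} (G : Graph n) → TriangleFree G → Dominated n (edgeCount G) (f₃ G)
graph⇒partition {n} G free =
  Dominated-resp (length-tabulate id)
    (≤-reflexive (#-vertexPairs (adj? G))) (≤-reflexive (sym (#-vertexPairs (triangleSaturating? G))))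
    (dominated n (allFin n) (≤-reflexive (length-tabulate id)) (allFin⁺ n))
  where
  open Saturation _≟ᶠ_ (adj? G) (triangleSaturating? G) (adj-sym G) (triangleSaturating-sym G)
    (proj₁ ∘ proj₂) (path⇒saturating G free)

-- The upper bound

-- Cuts the available edges down to exactly `m`. Uniqueness ensures that the disjunct `y ≡ x` adds
-- only one to the count.
select : ∀ {A : Set} → DecidableEquality A → {P : Pred A 0ℓ} (P? : Decidable P) {xs : List A} → Unique xs →
         ∀ m → m ≤ # P? xs → Σ[ Q ∈ Pred A 0ℓ ] Σ[ Q? ∈ Decidable Q ] (∀ {x} → Q x → P x) × # Q? xs ≡ m
select _≟_ P? {xs} uniq zero m≤ =
  (λ _ → ⊥) , ⊥? , (λ ()) , cong length (filter-none ⊥? (All.universal (λ _ ()) xs))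
  where
  ⊥? : Decidable (λ _ → ⊥)
  ⊥? _ = no λ ()
select _≟_ P? {x ∷ xs} uniq@(_ ∷ u) (suc m) m≤ with P? x
... | no ¬px with Q , Q? , Q⇒P , eq ← select _≟_ P? u (suc m) m≤ =
  Q , Q? , Q⇒P , trans (#-no Q? xs (¬px ∘ Q⇒P)) eq
select _≟_ {P} P? {x ∷ xs} uniq@(_ ∷ u) (suc m) m≤ | yes px
  with Q , Q? , Q⇒P , eq ← select _≟_ P? u m (s≤s⁻¹ m≤) =
  (λ y → y ≡ x ⊎ Q y) , Q′? , (λ { (inj₁ refl) → px ; (inj₂ q) → Q⇒P q }) ,
  trans (#-yes Q′? xs (inj₁ refl)) (cong suc (trans
    (#-cong Q′? Q? xs (λ { y∈ (inj₁ refl) → contradiction y∈ (Unique[x∷xs]⇒x∉xs uniq) ; _ (inj₂ q) → q })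
                      (λ _ → inj₂)) eq))
  where
  Q′? : Decidable (λ y → y ≡ x ⊎ Q y)
  Q′? y = (y ≟ x) ⊎-dec Q? y

-- Realising a list of labels as a graph.

-- A vertex of a disjoint union of complete bipartite graphs: its component and its side.
Label : Set
Label = ℕ × Bool

Opposite Same : Rel Label 0ℓ
Opposite (i , a) (j , b) = i ≡ j × a ≢ b
Same = _≡_

opposite? : Decidable₂ Opposite
opposite? (i , a) (j , b) = (i ≟ j) ×-dec ¬? (a Bool.≟ b)

same? : Decidable₂ Same
same? = ≡-dec _≟_ Bool._≟_

opposite-sym : Symmetric Opposite
opposite-sym (refl , a≢b) = refl , a≢b ∘ sym

opposite-path : ∀ {x y z} → Opposite x y → Opposite y z → Same x z
opposite-path {i , a} {_ , b} {_ , c} (refl , a≢b) (refl , b≢c) = cong (i ,_) (two-values a b c a≢b b≢c)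
  where
  two-values : ∀ a b c → a ≢ b → b ≢ c → a ≡ c
  two-values false false _     a≢b _   = contradiction refl a≢b
  two-values true  true  _     a≢b _   = contradiction refl a≢b
  two-values false true  true  _   b≢c = contradiction refl b≢c
  two-values true  false false _   b≢c = contradiction refl b≢c
  two-values false true  false _   _   = refl
  two-values true  false true  _   _   = refl

module Realisation (ls : List Label) (m : ℕ) (m≤ : m ≤ pairs opposite? ls) where

  n : ℕ
  n = length ls

  label : Fin n → Label
  label = lookup ls

  pairs-label : ∀ {R : Rel Label 0ℓ} (R? : Decidable₂ R) →
                pairs (λ x y → R? (label x) (label y)) (allFin n) ≡ pairs R? ls
  pairs-label R? = trans (sym (pairs-map R? label (allFin n)))
    (cong (pairs R?) (trans (map-tabulate id label) (tabulate-lookup ls)))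

  opp? : Decidable₂ (λ (x y : Fin n) → Opposite (label x) (label y))
  opp? x y = opposite? (label x) (label y)

  chosen : Σ[ Q ∈ Pred (Fin n × Fin n) 0ℓ ] Σ[ Q? ∈ Decidable Q ]
           (∀ {p} → Q p → Opposite (label (proj₁ p)) (label (proj₂ p))) × # Q? (vertexPairs n) ≡ m
  chosen = select (≡-dec _≟ᶠ_ _≟ᶠ_) (uncurry opp?)
    (filter⁺ (uncurry _<?_) (cartesianProduct⁺ (allFin⁺ n) (allFin⁺ n))) m
    (subst (m ≤_) (sym (trans (#-vertexPairs opp?) (pairs-label opposite?))) m≤)

  Q   = proj₁ chosen
  Q?  = proj₁ (proj₂ chosen)
  Q⇒Opposite = proj₁ (proj₂ (proj₂ chosen))

  -- `Q` is counted only on the pairs with smaller vertex first, so it is restricted to these and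
  -- then symmetrised.
  Edge : Rel (Fin n) 0ℓ
  Edge x y = (x <ᶠ y × Q (x , y)) ⊎ (y <ᶠ x × Q (y , x))

  edge? : Decidable₂ Edge
  edge? x y = (x <? y ×-dec Q? (x , y)) ⊎-dec (y <? x ×-dec Q? (y , x))

  edge⇒opposite : ∀ {x y} → Edge x y → Opposite (label x) (label y)
  edge⇒opposite (inj₁ (_ , q)) = Q⇒Opposite q
  edge⇒opposite (inj₂ (_ , q)) = opposite-sym (Q⇒Opposite q)

  graph : Graph n
  graph = record
    { Adj        = Edge
    ; adj?       = edge?
    ; adj-sym    = λ { (inj₁ xy) → inj₂ xy ; (inj₂ yx) → inj₁ yx }
    ; adj-irrefl = λ { refl (inj₁ (x<x , _)) → Fin.<-irrefl refl x<x
                     ; refl (inj₂ (x<x , _)) → Fin.<-irrefl refl x<x }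
    }

  triangle-free : TriangleFree graph
  triangle-free (x , y , z , xy , yz , xz) =
    proj₂ (edge⇒opposite xz) (cong proj₂ (opposite-path (edge⇒opposite xy) (edge⇒opposite yz)))

  edgeCount≡m : edgeCount graph ≡ m
  edgeCount≡m = trans (#-cong (uncurry edge?) Q? (vertexPairs n) forget recall) (proj₂ (proj₂ (proj₂ chosen)))
    where
    <-of : ∀ {p} → p ∈ vertexPairs n → proj₁ p <ᶠ proj₂ p
    <-of p∈ = proj₂ (∈-filter⁻ (uncurry _<?_) {xs = cartesianProduct (allFin n) (allFin n)} p∈)
    forget : ∀ {p} → p ∈ vertexPairs n → uncurry Edge p → Q p
    forget p∈ (inj₁ (_ , q))   = q
    forget p∈ (inj₂ (y<x , _)) = contradiction (<-of p∈) (Fin.<-asym y<x)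
    recall : ∀ {p} → p ∈ vertexPairs n → Q p → uncurry Edge p
    recall p∈ q = inj₁ (<-of p∈ , q)

-- As `G` has no triangle, one of the three edges is the new one. Irreflexivity keeps the other two
-- from being new, so the third vertex is a common neighbour of `x` and `y`.
saturating⇒common-neighbour : ∀ {n} (G : Graph n) → TriangleFree G → ∀ {x y} →
  TriangleSaturating G x y → ∃[ z ] Adj G x z × Adj G z y
saturating⇒common-neighbour G free {x} {y} (x≢y , _ , u , v , w , uv , vw , uw) = by-new uv vw uw
  where
  G⁺ = addEdge G x≢y
  apex : ∀ {z} → Adj G⁺ x z → Adj G⁺ z y → ∃[ z ] Adj G x z × Adj G z y
  apex {z} (inj₁ xz)                 (inj₁ zy)                 = z , xz , zy
  apex     (inj₁ xz)                 (inj₂ (inj₁ (refl , _)))  = contradiction xz (adj-irrefl G refl)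
  apex     (inj₁ xz)                 (inj₂ (inj₂ (_ , refl)))  = contradiction refl x≢y
  apex     (inj₂ (inj₁ (_ , refl)))  zy                        = contradiction zy (adj-irrefl G⁺ refl)
  apex     (inj₂ (inj₂ (refl , _)))  _                         = contradiction refl x≢y
  by-new : Adj G⁺ u v → Adj G⁺ v w → Adj G⁺ u w → ∃[ z ] Adj G x z × Adj G z y
  by-new (inj₂ (inj₁ (refl , refl))) vw uw = apex uw (adj-sym G⁺ {x = v} {y = w} vw)
  by-new (inj₂ (inj₂ (refl , refl))) vw uw = apex vw (adj-sym G⁺ {x = u} {y = w} uw)
  by-new uv@(inj₁ _) (inj₂ (inj₁ (refl , refl))) uw = apex (adj-sym G⁺ {x = u} {y = v} uv) uw
  by-new uv@(inj₁ _) (inj₂ (inj₂ (refl , refl))) uw = apex (adj-sym G⁺ {x = u} {y = w} uw) uv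
  by-new uv@(inj₁ _) vw@(inj₁ _) (inj₂ (inj₁ (refl , refl))) = apex uv vw
  by-new uv@(inj₁ _) vw@(inj₁ _) (inj₂ (inj₂ (refl , refl))) =
    apex (adj-sym G⁺ {x = v} {y = w} vw) (adj-sym G⁺ {x = u} {y = v} uv)
  by-new (inj₁ uv) (inj₁ vw) (inj₁ uw) = contradiction (u , v , w , uv , vw , uw) free

-- Every edge joins opposite labels, so the ends of a path of length two have the same label. This
-- survives the deletion of edges and bounds the saturating pairs.
realise : ∀ ls m → m ≤ pairs opposite? ls →
  Σ[ G ∈ Graph (length ls) ] (TriangleFree G × edgeCount G ≡ m × f₃ G ≤ pairs same? ls)
realise ls m m≤ = graph , triangle-free , edgeCount≡m ,
  ≤-trans (≤-reflexive (#-vertexPairs (triangleSaturating? graph)))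
    (≤-trans (pairs-mono (triangleSaturating? graph) (λ x y → same? (label x) (label y)) (allFin n) same-label)
             (≤-reflexive (pairs-label same?)))
  where
  open Realisation ls m m≤
  same-label : ∀ {x y} → TriangleSaturating graph x y → Same (label x) (label y)
  same-label ts with z , xz , zy ← saturating⇒common-neighbour graph triangle-free ts =
    opposite-path (edge⇒opposite xz) (edge⇒opposite zy)

-- Labels of a union of balanced complete bipartite graphs.

block : ℕ → ℕ → List Label
block i q = replicate ⌊ q /2⌋ (i , false) ++ replicate ⌈ q /2⌉ (i , true)

-- The index of a block is the number of parts after it, so different blocks have different indices.
labels : ∀ {k} → Vec ℕ k → List Label
labels                 []       = []
labels {suc k} (q ∷ qs) = block k q ++ labels qs

∈-replicate⇒≡ : ∀ {A : Set} n {x y : A} → x ∈ replicate n y → x ≡ y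
∈-replicate⇒≡ n {y = y} = All.lookup {P = _≡ y} (replicate⁺ n refl)

block-index : ∀ {i q l} → l ∈ block i q → proj₁ l ≡ i
block-index {i} {q} l∈ with ∈-++⁻ (replicate ⌊ q /2⌋ (i , false)) l∈
... | inj₁ l∈ˡ = cong proj₁ (∈-replicate⇒≡ ⌊ q /2⌋ l∈ˡ)
... | inj₂ l∈ʳ = cong proj₁ (∈-replicate⇒≡ ⌈ q /2⌉ l∈ʳ)

labels-index : ∀ {k} (qs : Vec ℕ k) {l} → l ∈ labels qs → proj₁ l < k
labels-index {suc k} (q ∷ qs) l∈ with ∈-++⁻ (block k q) l∈
... | inj₁ l∈b = s≤s (≤-reflexive (block-index {k} {q} l∈b))
... | inj₂ l∈r = m≤n⇒m≤1+n (labels-index qs l∈r)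

length-block : ∀ i q → length (block i q) ≡ q
length-block i q = trans (length-++ (replicate ⌊ q /2⌋ (i , false)))
  (trans (cong₂ _+_ (length-replicate ⌊ q /2⌋) (length-replicate ⌈ q /2⌉)) (⌊n/2⌋+⌈n/2⌉≡n q))

length-labels : ∀ {k} (qs : Vec ℕ k) → length (labels qs) ≡ Vec.sum qs
length-labels         []       = refl
length-labels {suc k} (q ∷ qs) =
  trans (length-++ (block k q)) (cong₂ _+_ (length-block k q) (length-labels qs))

replicate-pairs : ∀ {A : Set} {R : Rel A 0ℓ} n {x} → R x x → AllPairs R (replicate n x)
replicate-pairs zero    r = []
replicate-pairs (suc n) r = replicate⁺ n r ∷ replicate-pairs n r

opposite-block : ∀ i q → t q ≤ pairs opposite? (block i q)
opposite-block i q = begin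
  t q                                     ≡⟨ cong t (⌊n/2⌋+⌈n/2⌉≡n q) ⟨
  t (⌊ q /2⌋ + ⌈ q /2⌉)                   ≤⟨ t[a+b]≤ab ⌊ q /2⌋ ⌈ q /2⌉ (⌈n/2⌉≡⌊n/2⌋+[0,1] q) ⟩
  ⌊ q /2⌋ * ⌈ q /2⌉                       ≡⟨ cong₂ _*_ (length-replicate ⌊ q /2⌋) (length-replicate ⌈ q /2⌉) ⟨
  length L * length R                     ≡⟨ cross-all opposite? L opposite-LR ⟨
  cross opposite? L R                     ≤⟨ m≤m+n _ _ ⟩
  cross opposite? L R + _                 ≡⟨ pairs-++ opposite? L R ⟨
  pairs opposite? (block i q)             ∎
  where
  open ≤-Reasoning
  L = replicate ⌊ q /2⌋ (i , false)
  R = replicate ⌈ q /2⌉ (i , true)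
  opposite-LR : ∀ {x y} → x ∈ L → y ∈ R → Opposite x y
  opposite-LR x∈ y∈ with refl ← ∈-replicate⇒≡ ⌊ q /2⌋ x∈ | refl ← ∈-replicate⇒≡ ⌈ q /2⌉ y∈ = refl , λ ()

same-block : ∀ i q → pairs same? (block i q) ≤ s q
same-block i q = begin
  pairs same? (block i q)                               ≡⟨ pairs-++ same? L R ⟩
  cross same? L R + (pairs same? L + pairs same? R)     ≡⟨ cong (_+ (pairs same? L + pairs same? R)) (cross-none same? L different) ⟩
  pairs same? L + pairs same? R                         ≤⟨ ≤s[a+b] ⌊ q /2⌋ ⌈ q /2⌉ (pairs same? L) (pairs same? R) (⌈n/2⌉≡⌊n/2⌋+[0,1] q) (count ⌊ q /2⌋) (count ⌈ q /2⌉) ⟩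
  s (⌊ q /2⌋ + ⌈ q /2⌉)                                 ≡⟨ cong s (⌊n/2⌋+⌈n/2⌉≡n q) ⟩
  s q                                                   ∎
  where
  open ≤-Reasoning
  L = replicate ⌊ q /2⌋ (i , false)
  R = replicate ⌈ q /2⌉ (i , true)
  different : ∀ {x y} → x ∈ L → y ∈ R → ¬ Same x y
  different x∈ y∈ refl with trans (sym (∈-replicate⇒≡ ⌊ q /2⌋ x∈)) (∈-replicate⇒≡ ⌈ q /2⌉ y∈)
  ... | ()
  count : ∀ n {l : Label} → n + 2 * pairs same? (replicate n l) ≡ n * n
  count n {l} = subst (λ a → a + 2 * pairs same? (replicate n l) ≡ a * a) (length-replicate n)
                      (pairs-all same? (replicate-pairs n refl))

separated : ∀ {k q} (qs : Vec ℕ k) {x y} → x ∈ block k q → y ∈ labels qs → proj₁ x ≢ proj₁ y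
separated {k} {q} qs x∈ y∈ eq = <-irrefl (trans (sym eq) (block-index {k} {q} x∈)) (labels-index qs y∈)

opposite-labels : ∀ {k} (qs : Vec ℕ k) → Vec.sum (Vec.map t qs) ≤ pairs opposite? (labels qs)
opposite-labels         []       = z≤n
opposite-labels {suc k} (q ∷ qs) = begin
  t q + Vec.sum (Vec.map t qs)                              ≤⟨ +-mono-≤ (opposite-block k q) (opposite-labels qs) ⟩
  pairs opposite? (block k q) + pairs opposite? (labels qs) ≤⟨ m≤n+m _ (cross opposite? (block k q) (labels qs)) ⟩
  cross opposite? (block k q) (labels qs) + _               ≡⟨ pairs-++ opposite? (block k q) (labels qs) ⟨
  pairs opposite? (labels (q ∷ qs))                         ∎
  where open ≤-Reasoning

same-labels : ∀ {k} (qs : Vec ℕ k) → pairs same? (labels qs) ≤ Vec.sum (Vec.map s qs)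
same-labels         []       = z≤n
same-labels {suc k} (q ∷ qs) = begin
  pairs same? (labels (q ∷ qs))                         ≡⟨ pairs-++ same? (block k q) (labels qs) ⟩
  cross same? (block k q) (labels qs) + P               ≡⟨ cong (_+ P) (cross-none same? (block k q)
                                                             (λ x∈ y∈ → separated {q = q} qs x∈ y∈ ∘ cong proj₁)) ⟩
  P                                                     ≤⟨ +-mono-≤ (same-block k q) (same-labels qs) ⟩
  s q + Vec.sum (Vec.map s qs)                          ∎
  where
  open ≤-Reasoning
  P = pairs same? (block k q) + pairs same? (labels qs)

Realisable : ℕ → ℕ → ℕ → Set₁
Realisable n m v = Σ[ G ∈ Graph n ] (TriangleFree G × edgeCount G ≡ m × f₃ G ≤ v)

partition⇒graph : ∀ {k} (qs : Vec ℕ k) m → m ≤ Vec.sum (Vec.map t qs) →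
                  Realisable (Vec.sum qs) m (Vec.sum (Vec.map s qs))
partition⇒graph qs m m≤ =
  subst (λ n → Realisable n m (Vec.sum (Vec.map s qs))) (length-labels qs)
    (let G , free , edges , f₃≤ = realise (labels qs) m (≤-trans m≤ (opposite-labels qs))
     in G , free , edges , ≤-trans f₃≤ (same-labels qs))

-- Finding a partition of least cost.

Parts : Set
Parts = ∃ (Vec ℕ)

bump : Parts → Parts
bump (zero  , [])     = zero , []
bump (suc k , q ∷ qs) = suc k , suc q ∷ qs

-- A composition of `suc n` starts with 1 or arises from one of `n` by enlarging its first part.
-- Since `bump` fixes the empty vector, the list also has spurious entries, which `cheapest` filters
-- out.
compositions : ℕ → List Parts
compositions zero    = (0 , []) ∷ []
compositions (suc n) =
  map (λ (k , qs) → suc k , 1 ∷ qs) (compositions n) ++ map bump (compositions n)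

∈-compositions : ∀ n {k} (qs : Vec ℕ k) → VecAll.All (_≥ 1) qs → Vec.sum qs ≡ n →
                 (k , qs) ∈ compositions n
∈-compositions zero    []                   []          _  = here refl
∈-compositions zero    (zero ∷ qs)          (() ∷ _)    _
∈-compositions zero    (suc q ∷ qs)         _           ()
∈-compositions (suc n) (1 ∷ qs)             (_ ∷ qs≥1)  eq =
  ∈-++⁺ˡ (∈-map⁺ _ (∈-compositions n qs qs≥1 (suc-injective eq)))
∈-compositions (suc n) (suc (suc q) ∷ qs)   (_ ∷ qs≥1)  eq =
  ∈-++⁺ʳ (map _ (compositions n)) (∈-map⁺ bump (∈-compositions n (suc q ∷ qs) (s≤s z≤n ∷ qs≥1) (suc-injective eq)))

cost : Parts → ℕ
cost (_ , qs) = Vec.sum (Vec.map s qs)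

Admissible : ℕ → ℕ → Pred Parts 0ℓ
Admissible n m (k , qs) =
  k ≥ 1 × VecAll.All (_≥ 1) qs × Vec.sum qs ≡ n × Vec.sum (Vec.map t qs) ≥ m

admissible? : ∀ n m → Decidable (Admissible n m)
admissible? n m (k , qs) =
  (k ≥? 1) ×-dec VecAll.all? (_≥? 1) qs ×-dec (Vec.sum qs ≟ n) ×-dec (Vec.sum (Vec.map t qs) ≥? m)

-- A finite search. The default of `argmin` is the single part `n`, admissible by `m ≤ t n`, so the
-- result is admissible.
cheapest : ∀ n m → n ≥ 1 → m ≤ t n →
  Σ[ p ∈ Parts ] Admissible n m p × (∀ {p′} → Admissible n m p′ → cost p ≤ cost p′)
cheapest n m n≥1 m≤t =
  best , argmin-all cost whole-admissible (all-filter (admissible? n m) (compositions n)) , minimal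
  where
  whole : Parts
  whole = 1 , n ∷ []
  whole-admissible : Admissible n m whole
  whole-admissible = s≤s z≤n , n≥1 ∷ [] , +-identityʳ n , ≤-trans m≤t (m≤m+n (t n) 0)
  candidates : List Parts
  candidates = filter (admissible? n m) (compositions n)
  best : Parts
  best = argmin cost whole candidates
  minimal : ∀ {p′} → Admissible n m p′ → cost best ≤ cost p′
  minimal {k , qs} adm@(_ , qs≥1 , sum≡n , _) =
    All.lookup (f[argmin]≤f[xs] whole candidates) (∈-filter⁺ (admissible? n m) (∈-compositions n qs qs≥1 sum≡n) adm)

theorem1p4 : ∀ (n m : ℕ) → n ≥ 1 → m ≤ t n →
    ∃[ v ] (IsMinimum (f₃-Values n m) v × IsMinimum (Partition-Values n m) v)
theorem1p4 n m n≥1 m≤t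
  with (k , qs) , (k≥1 , qs≥1 , refl , m≤) , minimal ← cheapest n m n≥1 m≤t
  with G , free , edges , f₃≤ ← partition⇒graph qs m m≤ =
  -- The graph realising the cheapest partition has `f₃` at most `v`; the lower bound `below` makes
  -- this an equality.
  v , ((G , free , edges , ≤-antisym f₃≤ (below G free edges)) ,
       (λ { w (G′ , free′ , edges′ , refl) → below G′ free′ edges′ })) ,
      ((k , qs , k≥1 , qs≥1 , refl , m≤ , refl) ,
       (λ { w (k′ , qs′ , k′≥1 , qs′≥1 , sum≡ , m≤′ , refl) → minimal (k′≥1 , qs′≥1 , sum≡ , m≤′) }))
  where
  v = cost (k , qs)
  below : (G : Graph (Vec.sum qs)) → TriangleFree G → edgeCount G ≡ m → v ≤ f₃ G
  below G free refl with graph⇒partition G free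
  -- The partition without parts, allowed by `Dominated`, has sum 0 and contradicts `n ≥ 1`.
  ... | zero  , []   , _     , sum≡ , _  , _   = contradiction (subst (_≥ 1) (sym sum≡) n≥1) λ ()
  ... | suc _ , qs′  , qs′≥1 , sum≡ , m≤ , ≤f₃ =
    ≤-trans (minimal {_ , qs′} (s≤s z≤n , qs′≥1 , sum≡ , m≤)) ≤f₃
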